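{- Let $(\alpha,\beta)\in\Delta_K$ and let $\varepsilon_n=\varepsilon(T^n(\alpha,\beta))$, $n\ge0$. Suppose that the sequence $\{\varepsilon_n\}_{n\ge0}$ is purely periodic with period length $l$. Then the matrix $M_{\varepsilon_0}M_{\varepsilon_1}\cdots M_{\varepsilon_{l-1}}$ is primitive, i.e. some positive power of it has all entries strictly positive.
   Context: Let $K\subset\mathbb{R}$ be a real cubic number field, $N=N_{K/\mathbb{Q}}$ its norm. Fix $r=p/q$ with $p,q$ positive coprime integers and $3\nmid p$. Let $\Delta_K=\{(\alpha,\beta)\in K^2:\ 1,\alpha,\beta \text{ linearly independent over }\mathbb{Q},\ \alpha,\beta>0,\ \alpha+\beta<1\}$ and $Ind=\{(i,j): i,j\in\{0,1,2\},\ i\neq j\}$. Let $\Delta=\{(x,y)\in\mathbb{R}^2: x,y\ge 0,\ x+y\le 1\}$ and $\triangle(1,2)=\{(x,y)\in\Delta: x\ge y\}$, $\triangle(2,1)=\{x\le y\}$, $\triangle(0,1)=\{2x+y-1\le 0\}$, $\triangle(1,0)=\{2x+y-1\ge 0\}$, $\triangle(0,2)=\{x+2y-1\le0\}$, $\triangle(2,0)=\{x+2y-1\ge 0\}$ (all subsets of $\Delta$). Maps $T_{(i,j)}:\triangle(i,j)\to\Delta$: $T_{(1,2)}(x,y)=(\frac{x-y}{1-y},\frac{y}{1-y})$, $T_{(2,1)}(x,y)=(\frac{x}{1-x},\frac{y-x}{1-x})$, $T_{(0,1)}(x,y)=(\frac{x}{1-x},\frac{y}{1-x})$, $T_{(1,0)}(x,y)=(\frac{2x+y-1}{x+y},\frac{y}{x+y})$,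 $T_{(0,2)}(x,y)=(\frac{x}{1-y},\frac{y}{1-y})$, $T_{(2,0)}(x,y)=(\frac{x}{x+y},\frac{x+2y-1}{x+y})$. For $(\alpha,\beta)\in\Delta_K$ put $\gamma=1-\alpha-\beta$ and $v_{\{1,2\}}=\frac{\alpha^r\beta^r}{|N(\alpha)N(\beta)|}$, $v_{\{0,1\}}=\frac{\alpha^r\gamma^r}{|N(\alpha)N(\gamma)|}$, $v_{\{0,2\}}=\frac{\beta^r\gamma^r}{|N(\beta)N(\gamma)|}$; the maximum is attained at a unique pair $\{i_0,j_0\}$. $\varepsilon(\alpha,\beta)$ is the ordered pair $(i,j)\in Ind$ with $\{i,j\}=\{i_0,j_0\}$ and $(\alpha,\beta)\in\triangle(i,j)$, and $T(\alpha,\beta)=T_{\varepsilon(\alpha,\beta)}(\alpha,\beta)$ (a map $\Delta_K\to\Delta_K$). For $(i,j)\in Ind$, $M_{(i,j)}=(m_{k\ell})_{0\le k,\ell\le2}$ with $m_{k\ell}=1$ if $k=\ell$ or $(k,\ell)=(i,j)$, and $0$ otherwise. -}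

module Defs where

open import Algebra.Bundles using (CommutativeRing; Semiring)
open import Algebra.Morphism.Structures using (IsRingHomomorphism)
import Algebra.Definitions.RawSemiring as RawSemiringDefs
import Algebra.Solver.Ring as RingSolver
open import Algebra.Solver.Ring.AlmostCommutativeRing
  using (fromCommutativeRing; _-Raw-AlmostCommutative⟶_)
open import Data.Bool.Base using (if_then_else_)
open import Data.Fin.Base using (Fin; zero; suc)
open import Data.Fin.Patterns using (0F; 1F; 2F)
import Data.Fin.Properties as Fin
open import Data.Integer.Base using (+_)
open import Data.Maybe.Base using (Maybe; just; nothing)
open import Data.Nat.Base as ℕ using (ℕ; zero; suc; NonZero)
open import Data.Nat.GeneralisedArithmetic using (fold)
import Data.Nat.Properties as ℕ
open import Data.Product.Base using (∃; _×_; _,_; proj₁; proj₂)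
open import Data.Rational.Base as ℚ using (ℚ; 0ℚ; +-*-rawRing)
import Data.Rational.Properties as ℚ
open import Data.Sum.Base using (_⊎_; inj₁; inj₂)
open import Data.Vec.Functional using (Vector; []; _∷_)
open import Level using (Level; _⊔_) renaming (suc to lsuc)
open import Relation.Binary.Core using (Rel)
open import Relation.Binary.Definitions using (tri<; tri≈; tri>)
open import Relation.Binary.PropositionalEquality as ≡ using (_≡_; refl)
open import Relation.Binary.Structures using (IsStrictTotalOrder)
import Relation.Binary.Construct.StrictToNonStrict as StrictToNonStrict
import Relation.Binary.Reasoning.Setoid as SetoidReasoning
open import Relation.Nullary using (¬_; Dec; yes; no; contradiction; ⌊_⌋)
open import Relation.Nullary.Decidable using (_×-dec_; _⊎-dec_)
open import Relation.Unary using (Pred; _∈_)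

------------------------------------------------------------------------
-- The ambient field of real numbers.
--
-- An Archimedean ordered field in which positive elements have n-th
-- roots.  The classical ℝ is one, and every such field embeds in ℝ as an
-- ordered field, compatibly with roots of positive elements; so a cubic
-- field inside some `RealField` is the same thing as a cubic number field
-- K ⊂ ℝ.  Completeness of ℝ is not imposed: only field operations,
-- comparisons and the powers x ^ (p / q) are ever applied to reals, and
-- without it the real algebraic numbers, whose order is decidable, are
-- also an instance.

record RealField c ℓ₁ ℓ₂ : Set (lsuc (c ⊔ ℓ₁ ⊔ ℓ₂)) where
  infix 4 _<_
  field
    commutativeRing : CommutativeRing c ℓ₁

  open CommutativeRing commutativeRing public
    hiding (zero) renaming (refl to ≈-refl; sym to ≈-sym; trans to ≈-trans)
  open RawSemiringDefs (Semiring.rawSemiring semiring) public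
    using (_^_; sum) renaming (_×_ to _·_)

  field
    _<_                : Rel Carrier ℓ₂
    isStrictTotalOrder : IsStrictTotalOrder _≈_ _<_
    0<1                : 0# < 1#
    +-monoˡ-<          : ∀ {x y} z → x < y → x + z < y + z
    *-pos              : ∀ {x y} → 0# < x → 0# < y → 0# < x * y
    inverse            : ∀ {x} → ¬ (x ≈ 0#) → ∃ λ y → x * y ≈ 1#
    archimedean        : ∀ x y → 0# < x → ∃ λ n → y < n · x
    root               : ∀ n .{{_ : NonZero n}} {x} → 0# < x →
                         ∃ λ y → (0# < y) × (y ^ n ≈ x)
    -- The (unique) embedding of ℚ.
    ι                  : ℚ → Carrier
    ι-isRingHomomorphism : IsRingHomomorphism +-*-rawRing rawRing ι

  open IsStrictTotalOrder isStrictTotalOrder public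
    using (compare; _≟_; _<?_; <-respˡ-≈; <-respʳ-≈)
    renaming (trans to <-trans; irrefl to <-irrefl; asym to <-asym)
  open StrictToNonStrict _≈_ _<_ public using (_≤_)
  open IsRingHomomorphism ι-isRingHomomorphism public
    using (⟦⟧-cong; +-homo; *-homo; -‿homo; 0#-homo; 1#-homo)

  _≤?_ : ∀ x y → Dec (x ≤ y)
  _≤?_ = StrictToNonStrict.decidable′ _≈_ _<_ compare

  -- Extended by 0 ⁻¹ = 0; no quotient below has a vanishing denominator.
  infix 8 _⁻¹
  _⁻¹ : Carrier → Carrier
  x ⁻¹ with x ≟ 0#
  ... | yes _   = 0#
  ... | no  x≉0 = proj₁ (inverse x≉0)

  infixl 7 _/_
  _/_ : Carrier → Carrier → Carrier
  x / y = x * y ⁻¹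

  ^-pos : ∀ n {x} → 0# < x → 0# < x ^ n
  ^-pos zero    0<x = 0<1
  ^-pos (suc n) 0<x = *-pos 0<x (^-pos n 0<x)

  -- The real number x ^ (p / q).
  rpow : (p q : ℕ) .{{_ : NonZero q}} → ∀ {x} → 0# < x → Carrier
  rpow p q 0<x = proj₁ (root q (^-pos p 0<x))

  LinearlyIndependent : ∀ {n} → Vector Carrier n → Set ℓ₁
  LinearlyIndependent {n} v =
    (c : Vector ℚ n) → sum (λ i → ι (c i) * v i) ≈ 0# → ∀ i → c i ≡ 0ℚ

2ℚ -1ℚ : ℚ
2ℚ  = + 2 ℚ./ 1
-1ℚ = ℚ.- ℚ.1ℚ

------------------------------------------------------------------------

record CubicField {c ℓ₁ ℓ₂} (R : RealField c ℓ₁ ℓ₂) k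
                  : Set (c ⊔ ℓ₁ ⊔ lsuc k) where
  open RealField R
  field
    K         : Pred Carrier k
    K-resp-≈  : ∀ {x y} → x ≈ y → x ∈ K → y ∈ K
    1∈K       : 1# ∈ K
    +-closed  : ∀ {x y} → x ∈ K → y ∈ K → x + y ∈ K
    -‿closed  : ∀ {x} → x ∈ K → - x ∈ K
    *-closed  : ∀ {x y} → x ∈ K → y ∈ K → x * y ∈ K
    ⁻¹-closed : ∀ {x} → x ∈ K → x ⁻¹ ∈ K
    -- [K : ℚ] = 3
    basis             : Vector Carrier 3
    basis∈K           : ∀ i → basis i ∈ K
    basis-independent : LinearlyIndependent basis
    basis-spans       : ∀ {x} → x ∈ K →
                        ∃ λ (a : Vector ℚ 3) → x ≈ sum (λ i → ι (a i) * basis i)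

  coordinates : ∀ {x} → x ∈ K → Vector ℚ 3
  coordinates x∈K = proj₁ (basis-spans x∈K)

  -- The determinant of the ℚ-linear map y ↦ x * y of K.
  norm : ∀ {x} → x ∈ K → ℚ
  norm x∈K =
      m 0F 0F ℚ.* (m 1F 1F ℚ.* m 2F 2F ℚ.- m 1F 2F ℚ.* m 2F 1F)
    ℚ.- m 0F 1F ℚ.* (m 1F 0F ℚ.* m 2F 2F ℚ.- m 1F 2F ℚ.* m 2F 0F)
    ℚ.+ m 0F 2F ℚ.* (m 1F 0F ℚ.* m 2F 1F ℚ.- m 1F 1F ℚ.* m 2F 0F)
    where
    m : Fin 3 → Fin 3 → ℚ
    m i j = coordinates (*-closed x∈K (basis∈K j)) i

------------------------------------------------------------------------
-- ⟨ij⟩ is the ordered pair (i , j), ｛ij｝ the unordered one.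

data Ind : Set where
  ⟨12⟩ ⟨21⟩ ⟨01⟩ ⟨10⟩ ⟨02⟩ ⟨20⟩ : Ind

fst snd : Ind → Fin 3
fst ⟨12⟩ = 1F
fst ⟨21⟩ = 2F
fst ⟨01⟩ = 0F
fst ⟨10⟩ = 1F
fst ⟨02⟩ = 0F
fst ⟨20⟩ = 2F
snd ⟨12⟩ = 2F
snd ⟨21⟩ = 1F
snd ⟨01⟩ = 1F
snd ⟨10⟩ = 0F
snd ⟨02⟩ = 2F
snd ⟨20⟩ = 0F

data Pair : Set where
  ｛12｝ ｛01｝ ｛02｝ : Pair

------------------------------------------------------------------------

Matrix : Set
Matrix = Fin 3 → Fin 3 → ℕ

1ᴹ : Matrix
1ᴹ i j = if ⌊ i Fin.≟ j ⌋ then 1 else 0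

infixl 7 _*ᴹ_
_*ᴹ_ : Matrix → Matrix → Matrix
(A *ᴹ B) i j = RawSemiringDefs.sum ℕ.+-*-rawSemiring (λ k → A i k ℕ.* B k j)

infixr 8 _^ᴹ_
_^ᴹ_ : Matrix → ℕ → Matrix
A ^ᴹ zero  = 1ᴹ
A ^ᴹ suc n = A *ᴹ A ^ᴹ n

M : Ind → Matrix
M e k l = if ⌊ (k Fin.≟ l) ⊎-dec ((k Fin.≟ fst e) ×-dec (l Fin.≟ snd e)) ⌋
          then 1 else 0

-- M (e 0) *ᴹ M (e 1) *ᴹ ⋯ *ᴹ M (e (l - 1))
productM : (ℕ → Ind) → ℕ → Matrix
productM e zero    = 1ᴹ
productM e (suc l) = M (e 0) *ᴹ productM (λ n → e (suc n)) l

Primitive : Matrix → Set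
Primitive A = ∃ λ n → (0 ℕ.< n) × (∀ i j → 0 ℕ.< (A ^ᴹ n) i j)

------------------------------------------------------------------------

module RealFieldProperties {c ℓ₁ ℓ₂} (R : RealField c ℓ₁ ℓ₂) where
  open RealField R

  private
    morphism : +-*-rawRing -Raw-AlmostCommutative⟶ fromCommutativeRing commutativeRing
    morphism = record
      { ⟦_⟧    = ι
      ; +-homo = +-homo
      ; *-homo = *-homo
      ; -‿homo = -‿homo
      ; 0-homo = 0#-homo
      ; 1-homo = 1#-homo
      }

    coeff≟ : ∀ a b → Maybe (ι a ≈ ι b)
    coeff≟ a b with a ℚ.≟ b
    ... | yes a≡b = just (⟦⟧-cong a≡b)
    ... | no  _   = nothing

  module Solver =
    RingSolver +-*-rawRing (fromCommutativeRing commutativeRing) morphism coeff≟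
  open Solver using (solve; _:=_; _:+_; _:*_; _:-_; :-_; con)

  x<y⇒0<y-x : ∀ {x y} → x < y → 0# < y - x
  x<y⇒0<y-x {x} x<y = <-respˡ-≈ (-‿inverseʳ x) (+-monoˡ-< (- x) x<y)

  0<y-x⇒x<y : ∀ {x y} → 0# < y - x → x < y
  0<y-x⇒x<y {x} {y} p = <-respˡ-≈ (+-identityˡ x)
    (<-respʳ-≈ (solve 2 (λ x y → (y :- x) :+ x := y) ≈-refl x y) (+-monoˡ-< x p))

  x≤y∧x≉y⇒x<y : ∀ {x y} → x ≤ y → ¬ (x ≈ y) → x < y
  x≤y∧x≉y⇒x<y (inj₁ x<y) _   = x<y
  x≤y∧x≉y⇒x<y (inj₂ x≈y) x≉y = contradiction x≈y x≉y

  ≤-refl : ∀ {x} → x ≤ x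
  ≤-refl = inj₂ ≈-refl

  ≤-trans : ∀ {x y z} → x ≤ y → y ≤ z → x ≤ z
  ≤-trans (inj₁ p) (inj₁ q) = inj₁ (<-trans p q)
  ≤-trans (inj₁ p) (inj₂ q) = inj₁ (<-respʳ-≈ q p)
  ≤-trans (inj₂ p) (inj₁ q) = inj₁ (<-respˡ-≈ (≈-sym p) q)
  ≤-trans (inj₂ p) (inj₂ q) = inj₂ (≈-trans p q)

  ≰⇒≥ : ∀ {x y} → ¬ (x ≤ y) → y ≤ x
  ≰⇒≥ {x} {y} x≰y with compare x y
  ... | tri< x<y _ _ = contradiction (inj₁ x<y) x≰y
  ... | tri≈ _ x≈y _ = contradiction (inj₂ x≈y) x≰y
  ... | tri> _ _ y<x = inj₁ y<x

  +-pos : ∀ {x y} → 0# < x → 0# < y → 0# < x + y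
  +-pos {x} {y} 0<x 0<y = <-trans 0<y (<-respˡ-≈ (+-identityˡ y) (+-monoˡ-< y 0<x))

  ⁻¹-inverseʳ : ∀ {x} → ¬ (x ≈ 0#) → x * x ⁻¹ ≈ 1#
  ⁻¹-inverseʳ {x} x≉0 with x ≟ 0#
  ... | yes x≈0 = contradiction x≈0 x≉0
  ... | no  x≉0 = proj₂ (inverse x≉0)

  0<x⇒x≉0 : ∀ {x} → 0# < x → ¬ (x ≈ 0#)
  0<x⇒x≉0 0<x x≈0 = <-irrefl (≈-sym x≈0) 0<x

  x<0⇒0<-x : ∀ {x} → x < 0# → 0# < - x
  x<0⇒0<-x {x} x<0 = <-respʳ-≈ (+-identityˡ (- x)) (x<y⇒0<y-x x<0)

  ⁻¹-pos : ∀ {x} → 0# < x → 0# < x ⁻¹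
  ⁻¹-pos {x} 0<x with compare 0# (x ⁻¹)
  ... | tri< 0<x⁻¹ _ _ = 0<x⁻¹
  ... | tri≈ _ 0≈x⁻¹ _ = contradiction
    (≈-trans (≈-sym (zeroʳ x)) (≈-trans (*-congˡ 0≈x⁻¹) (⁻¹-inverseʳ (0<x⇒x≉0 0<x))))
    (λ 0≈1 → <-irrefl 0≈1 0<1)
  ... | tri> _ _ x⁻¹<0 = contradiction
    (<-respʳ-≈
      (≈-trans (solve 2 (λ x y → x :* (:- y) := :- (x :* y)) ≈-refl x (x ⁻¹))
               (-‿cong (⁻¹-inverseʳ (0<x⇒x≉0 0<x))))
      (*-pos 0<x (x<0⇒0<-x x⁻¹<0)))
    (λ 0<-1 → <-asym 0<1 (0<y-x⇒x<y (<-respʳ-≈ (≈-sym (+-identityˡ (- 1#))) 0<-1)))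

------------------------------------------------------------------------
-- The exponent is r = p / q.

module Algorithm {c ℓ₁ ℓ₂ k} (R : RealField c ℓ₁ ℓ₂) (F : CubicField R k)
                 (p q : ℕ) .{{_ : NonZero q}} where
  open RealField R
  open CubicField F
  open RealFieldProperties R
  open Solver using (solve; _:=_; _:+_; _:*_; _:-_; :-_; con)

  record InΔK (α β : Carrier) : Set (ℓ₁ ⊔ ℓ₂ ⊔ k) where
    field
      α∈K         : α ∈ K
      β∈K         : β ∈ K
      independent : LinearlyIndependent (1# ∷ α ∷ β ∷ [])
      0<α         : 0# < α
      0<β         : 0# < β
      α+β<1       : α + β < 1#

    γ : Carrier
    γ = 1# - α - β

    γ∈K : γ ∈ K
    γ∈K = +-closed (+-closed 1∈K (-‿closed α∈K)) (-‿closed β∈K)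

    0<γ : 0# < γ
    0<γ = <-respʳ-≈ (solve 3 (λ o a b → o :- (a :+ b) := o :- a :- b) ≈-refl 1# α β)
                    (x<y⇒0<y-x α+β<1)

  record ΔK : Set (c ⊔ ℓ₁ ⊔ ℓ₂ ⊔ k) where
    field
      α β  : Carrier
      inΔK : InΔK α β
    open InΔK inΔK public

    point : Carrier × Carrier
    point = α , β

  open ΔK

  -- For 0<x : 0# < x, the term 0<x ^r is the real number x ^ r.
  infix 9 _^r
  _^r : ∀ {x} → 0# < x → Carrier
  0<x ^r = rpow p q 0<x

  v : Pair → ΔK → Carrier
  v ｛12｝ P = (0<α P ^r * 0<β P ^r) / ι ℚ.∣ norm (α∈K P) ℚ.* norm (β∈K P) ∣
  v ｛01｝ P = (0<α P ^r * 0<γ P ^r) / ι ℚ.∣ norm (α∈K P) ℚ.* norm (γ∈K P) ∣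
  v ｛02｝ P = (0<β P ^r * 0<γ P ^r) / ι ℚ.∣ norm (β∈K P) ℚ.* norm (γ∈K P) ∣

  larger : ΔK → Pair → Pair → Pair
  larger P s t = if ⌊ v t P ≤? v s P ⌋ then s else t

  -- The pair {i₀ , j₀} maximising v.  For p, q coprime and 3 ∤ p it is the
  -- only one, so the way `larger` breaks ties is immaterial.
  maxPair : ΔK → Pair
  maxPair P = larger P ｛12｝ (larger P ｛01｝ ｛02｝)

  maxPair-max : ∀ P s → v s P ≤ v (maxPair P) P
  maxPair-max P = λ where
      ｛12｝ → larger-≥ˡ ｛12｝ _
      ｛01｝ → ≤-trans (larger-≥ˡ ｛01｝ ｛02｝) (larger-≥ʳ ｛12｝ _)
      ｛02｝ → ≤-trans (larger-≥ʳ ｛01｝ ｛02｝) (larger-≥ʳ ｛12｝ _)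
    where
    larger-≥ˡ : ∀ s t → v s P ≤ v (larger P s t) P
    larger-≥ˡ s t with v t P ≤? v s P
    ... | yes _  = ≤-refl
    ... | no t≰s = ≰⇒≥ t≰s
    larger-≥ʳ : ∀ s t → v t P ≤ v (larger P s t) P
    larger-≥ʳ s t with v t P ≤? v s P
    ... | yes t≤s = t≤s
    ... | no _    = ≤-refl

  2# : Carrier
  2# = ι 2ℚ

  -- (x , y) ∈ △ e is membership in △(i,j) for points already known to lie
  -- in Δ.
  △ : Ind → Carrier × Carrier → Set (ℓ₁ ⊔ ℓ₂)
  △ ⟨12⟩ (x , y) = y ≤ x
  △ ⟨21⟩ (x , y) = x ≤ y
  △ ⟨01⟩ (x , y) = 2# * x + y - 1# ≤ 0#
  △ ⟨10⟩ (x , y) = 0# ≤ 2# * x + y - 1#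
  △ ⟨02⟩ (x , y) = x + 2# * y - 1# ≤ 0#
  △ ⟨20⟩ (x , y) = 0# ≤ x + 2# * y - 1#

  T⟨_⟩ : Ind → Carrier × Carrier → Carrier × Carrier
  T⟨ ⟨12⟩ ⟩ (x , y) = (x - y) / (1# - y) , y / (1# - y)
  T⟨ ⟨21⟩ ⟩ (x , y) = x / (1# - x) , (y - x) / (1# - x)
  T⟨ ⟨01⟩ ⟩ (x , y) = x / (1# - x) , y / (1# - x)
  T⟨ ⟨10⟩ ⟩ (x , y) = (2# * x + y - 1#) / (x + y) , y / (x + y)
  T⟨ ⟨02⟩ ⟩ (x , y) = x / (1# - y) , y / (1# - y)
  T⟨ ⟨20⟩ ⟩ (x , y) = x / (x + y) , (x + 2# * y - 1#) / (x + y)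

  ε-on : ∀ P → Pair → ∃ λ e → △ e (point P)
  ε-on P ｛12｝ with β P ≤? α P
  ... | yes β≤α = ⟨12⟩ , β≤α
  ... | no  β≰α = ⟨21⟩ , ≰⇒≥ β≰α
  ε-on P ｛01｝ with (2# * α P + β P - 1#) ≤? 0#
  ... | yes ≤0 = ⟨01⟩ , ≤0
  ... | no  ≰0 = ⟨10⟩ , ≰⇒≥ ≰0
  ε-on P ｛02｝ with (α P + 2# * β P - 1#) ≤? 0#
  ... | yes ≤0 = ⟨02⟩ , ≤0
  ... | no  ≰0 = ⟨20⟩ , ≰⇒≥ ≰0

  ε : ΔK → Ind
  ε P = proj₁ (ε-on P (maxPair P))

  ε∈△ : ∀ P → △ (ε P) (point P)
  ε∈△ P = proj₂ (ε-on P (maxPair P))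

  lincomb : Vector ℚ 3 → Carrier → Carrier → Carrier → Carrier
  lincomb a x y z = ι (a 0F) * x + ι (a 1F) * y + ι (a 2F) * z

  sum≈lincomb : ∀ a x y z →
    sum (λ i → ι (a i) * (x ∷ y ∷ z ∷ []) i) ≈ lincomb a x y z
  sum≈lincomb a x y z = ≈-trans (+-congˡ (+-congˡ (+-identityʳ _))) (≈-sym (+-assoc _ _ _))

  -- The point (A / D , B / D), given the three barycentric coordinates
  -- G , A , B up to the factor D.
  rescale : ∀ {A B D} G → A ∈ K → B ∈ K → D ∈ K →
            0# < A → 0# < B → 0# < G → D ≈ A + B + G →
            (∀ a → lincomb a D A B ≈ 0# → ∀ i → a i ≡ 0ℚ) →
            InΔK (A / D) (B / D)
  rescale {A} {B} {D} G A∈K B∈K D∈K 0<A 0<B 0<G D≈ ind = record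
    { α∈K = *-closed A∈K (⁻¹-closed D∈K)
    ; β∈K = *-closed B∈K (⁻¹-closed D∈K)
    ; independent = λ a eq → ind a (begin
        lincomb a D A B
          ≈⟨ +-cong (+-congˡ (*-congˡ (*D A))) (*-congˡ (*D B)) ⟩
        lincomb a D (D * (A / D)) (D * (B / D))
          ≈⟨ solve 6 (λ a b c d x y → a :* d :+ b :* (d :* x) :+ c :* (d :* y)
                      := d :* (a :+ b :* x :+ c :* y)) ≈-refl
               (ι (a 0F)) (ι (a 1F)) (ι (a 2F)) D (A / D) (B / D) ⟩
        D * (ι (a 0F) + ι (a 1F) * (A / D) + ι (a 2F) * (B / D))
          ≈⟨ *-congˡ (+-congʳ (+-congʳ (≈-sym (*-identityʳ _)))) ⟩
        D * lincomb a 1# (A / D) (B / D)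
          ≈⟨ *-congˡ (≈-trans (≈-sym (sum≈lincomb a 1# _ _)) eq) ⟩
        D * 0#
          ≈⟨ zeroʳ D ⟩
        0# ∎)
    ; 0<α = *-pos 0<A 0<D⁻¹
    ; 0<β = *-pos 0<B 0<D⁻¹
    ; α+β<1 = 0<y-x⇒x<y (<-respʳ-≈ (begin
        G / D
          ≈⟨ solve 4 (λ a b g i → g :* i := (a :+ b :+ g) :* i :- (a :* i :+ b :* i))
               ≈-refl A B G (D ⁻¹) ⟩
        (A + B + G) / D - (A / D + B / D)
          ≈⟨ +-congʳ (*-congʳ (≈-sym D≈)) ⟩
        D / D - (A / D + B / D)
          ≈⟨ +-congʳ D/D≈1 ⟩
        1# - (A / D + B / D) ∎) (*-pos 0<G 0<D⁻¹))
    }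
    where
    open SetoidReasoning setoid
    0<D : 0# < D
    0<D = <-respʳ-≈ (≈-sym D≈) (+-pos (+-pos 0<A 0<B) 0<G)
    0<D⁻¹ : 0# < D ⁻¹
    0<D⁻¹ = ⁻¹-pos 0<D
    D/D≈1 : D / D ≈ 1#
    D/D≈1 = ⁻¹-inverseʳ (0<x⇒x≉0 0<D)
    *D : ∀ x → x ≈ D * (x / D)
    *D x = begin
      x             ≈⟨ *-identityʳ x ⟨
      x * 1#        ≈⟨ *-congˡ D/D≈1 ⟨
      x * (D / D)   ≈⟨ solve 3 (λ x d i → x :* (d :* i) := d :* (x :* i)) ≈-refl x D (D ⁻¹) ⟩
      D * (x / D)   ∎

  module Preservation (P : ΔK) where
    x y : Carrier
    x = α P
    y = β P

    independent₃ : ∀ a b c → ι a * 1# + ι b * x + ι c * y ≈ 0# →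
                   (a ≡ 0ℚ) × (b ≡ 0ℚ) × (c ≡ 0ℚ)
    independent₃ a b c eq = h 0F , h 1F , h 2F
      where
      h : ∀ i → (a ∷ b ∷ c ∷ []) i ≡ 0ℚ
      h = independent P (a ∷ b ∷ c ∷ [])
            (≈-trans (sum≈lincomb (a ∷ b ∷ c ∷ []) _ _ _) eq)

    all-zero : ∀ {a : Vector ℚ 3} → a 0F ≡ 0ℚ → a 1F ≡ 0ℚ → a 2F ≡ 0ℚ → ∀ i → a i ≡ 0ℚ
    all-zero p q r 0F = p
    all-zero p q r 1F = q
    all-zero p q r 2F = r

    +0 : ∀ {a b} → a ≡ 0ℚ → b ℚ.+ a ≡ 0ℚ → b ≡ 0ℚ
    +0 {b = b} refl eq = ≡.trans (≡.sym (ℚ.+-identityʳ b)) eq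
    0+ : ∀ {a b} → a ≡ 0ℚ → a ℚ.+ b ≡ 0ℚ → b ≡ 0ℚ
    0+ {b = b} refl eq = ≡.trans (≡.sym (ℚ.+-identityˡ b)) eq
    sum0 : ∀ {a b} → a ≡ 0ℚ → b ≡ 0ℚ → a ℚ.+ b ≡ 0ℚ
    sum0 refl refl = refl
    neg0 : ∀ {a} → a ≡ 0ℚ → ℚ.- a ≡ 0ℚ
    neg0 refl = refl
    0neg : ∀ {a} → ℚ.- a ≡ 0ℚ → a ≡ 0ℚ
    0neg eq = ℚ.neg-injective eq

    weights : ∀ {d₀ d₁ d₂ e₀ e₁ e₂ s} → ι d₀ ≈ e₀ → ι d₁ ≈ e₁ → ι d₂ ≈ e₂ →
              e₀ * 1# + e₁ * x + e₂ * y ≈ s → s ≈ 0# →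
              (d₀ ≡ 0ℚ) × (d₁ ≡ 0ℚ) × (d₂ ≡ 0ℚ)
    weights p q r eq s≈0 = independent₃ _ _ _
      (≈-trans (+-cong (+-cong (*-congʳ p) (*-congʳ q)) (*-congʳ r)) (≈-trans eq s≈0))

    ι[b-a] : ∀ b a → ι (b ℚ.+ ℚ.- a) ≈ ι b - ι a
    ι[b-a] b a = ≈-trans (+-homo _ _) (+-congˡ (-‿homo a))
    ι[c-ab] : ∀ c a b → ι (c ℚ.+ ℚ.- (a ℚ.+ b)) ≈ ι c - (ι a + ι b)
    ι[c-ab] c a b = ≈-trans (ι[b-a] _ _) (+-congˡ (-‿cong (+-homo a b)))
    ι[a+bc] : ∀ a b c → ι (a ℚ.+ (b ℚ.+ c)) ≈ ι a + (ι b + ι c)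
    ι[a+bc] a b c = ≈-trans (+-homo _ _) (+-congˡ (+-homo b c))

    -K : ∀ {a b} → a ∈ K → b ∈ K → a - b ∈ K
    -K p q = +-closed p (-‿closed q)
    2∈K : 2# ∈ K
    2∈K = K-resp-≈ (≈-sym (≈-trans (+-homo ℚ.1ℚ ℚ.1ℚ) (+-cong 1#-homo 1#-homo)))
                   (+-closed 1∈K 1∈K)
    x∈K : x ∈ K
    x∈K = α∈K P
    y∈K : y ∈ K
    y∈K = β∈K P

    x≉y : ¬ (x ≈ y)
    x≉y x≈y = contradiction (proj₁ (proj₂ (independent₃ 0ℚ ℚ.1ℚ -1ℚ (≈-trans
      (solve 3 (λ o x y → con 0ℚ :* o :+ con ℚ.1ℚ :* x :+ con -1ℚ :* y := x :- y)
             ≈-refl 1# x y)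
      (≈-trans (+-congʳ x≈y) (-‿inverseʳ y)))))) λ ()

    2x+y-1 x+2y-1 : Carrier
    2x+y-1 = 2# * x + y - 1#
    x+2y-1 = x + 2# * y - 1#

    2x+y-1≉0 : ¬ (2x+y-1 ≈ 0#)
    2x+y-1≉0 eq = contradiction (proj₁ (independent₃ -1ℚ 2ℚ ℚ.1ℚ (≈-trans
      (solve 3 (λ o x y → con -1ℚ :* o :+ con 2ℚ :* x :+ con ℚ.1ℚ :* y
                       := con 2ℚ :* x :+ y :- o) ≈-refl 1# x y) eq))) λ ()

    x+2y-1≉0 : ¬ (x+2y-1 ≈ 0#)
    x+2y-1≉0 eq = contradiction (proj₁ (independent₃ -1ℚ ℚ.1ℚ 2ℚ (≈-trans
      (solve 3 (λ o x y → con -1ℚ :* o :+ con ℚ.1ℚ :* x :+ con 2ℚ :* y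
                       := x :+ con 2ℚ :* y :- o) ≈-refl 1# x y) eq))) λ ()

    preserves : ∀ e → △ e (point P) →
                InΔK (proj₁ (T⟨ e ⟩ (point P))) (proj₂ (T⟨ e ⟩ (point P)))
    preserves ⟨12⟩ y≤x = rescale (γ P) (-K x∈K y∈K) y∈K (-K 1∈K y∈K)
      (x<y⇒0<y-x (x≤y∧x≉y⇒x<y y≤x (λ eq → x≉y (≈-sym eq)))) (0<β P) (0<γ P)
      (solve 3 (λ o x y → o :- y := (x :- y) :+ y :+ (o :- x :- y)) ≈-refl 1# x y)
      (λ a eq → let (d₀ , d₁ , d₂) = weights ≈-refl ≈-refl (ι[c-ab] (a 2F) (a 0F) (a 1F))
                      (solve 6 (λ a b c o x y → a :* o :+ b :* x :+ (c :- (a :+ b)) :* y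
                                 := a :* (o :- y) :+ b :* (x :- y) :+ c :* y)
                         ≈-refl _ _ _ 1# x y) eq
                in all-zero d₀ d₁ (+0 (neg0 (sum0 d₀ d₁)) d₂))
    preserves ⟨21⟩ x≤y = rescale (γ P) x∈K (-K y∈K x∈K) (-K 1∈K x∈K)
      (0<α P) (x<y⇒0<y-x (x≤y∧x≉y⇒x<y x≤y x≉y)) (0<γ P)
      (solve 3 (λ o x y → o :- x := x :+ (y :- x) :+ (o :- x :- y)) ≈-refl 1# x y)
      (λ a eq → let (d₀ , d₁ , d₂) = weights ≈-refl (ι[c-ab] (a 1F) (a 0F) (a 2F)) ≈-refl
                      (solve 6 (λ a b c o x y → a :* o :+ (b :- (a :+ c)) :* x :+ c :* y
                                 := a :* (o :- x) :+ b :* x :+ c :* (y :- x))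
                         ≈-refl _ _ _ 1# x y) eq
                in all-zero d₀ (+0 (neg0 (sum0 d₀ d₂)) d₁) d₂)
    preserves ⟨01⟩ ≤0 = rescale (- 2x+y-1) x∈K y∈K (-K 1∈K x∈K)
      (0<α P) (0<β P) (x<0⇒0<-x (x≤y∧x≉y⇒x<y ≤0 2x+y-1≉0))
      (solve 3 (λ o x y → o :- x := x :+ y :+ (:- (con 2ℚ :* x :+ y :- o))) ≈-refl 1# x y)
      (λ a eq → let (d₀ , d₁ , d₂) = weights ≈-refl (ι[b-a] (a 1F) (a 0F)) ≈-refl
                      (solve 6 (λ a b c o x y → a :* o :+ (b :- a) :* x :+ c :* y
                                 := a :* (o :- x) :+ b :* x :+ c :* y)
                         ≈-refl _ _ _ 1# x y) eq
                in all-zero d₀ (+0 (neg0 d₀) d₁) d₂)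
    preserves ⟨02⟩ ≤0 = rescale (- x+2y-1) x∈K y∈K (-K 1∈K y∈K)
      (0<α P) (0<β P) (x<0⇒0<-x (x≤y∧x≉y⇒x<y ≤0 x+2y-1≉0))
      (solve 3 (λ o x y → o :- y := x :+ y :+ (:- (x :+ con 2ℚ :* y :- o))) ≈-refl 1# x y)
      (λ a eq → let (d₀ , d₁ , d₂) = weights ≈-refl ≈-refl (ι[b-a] (a 2F) (a 0F))
                      (solve 6 (λ a b c o x y → a :* o :+ b :* x :+ (c :- a) :* y
                                 := a :* (o :- y) :+ b :* x :+ c :* y)
                         ≈-refl _ _ _ 1# x y) eq
                in all-zero d₀ d₁ (+0 (neg0 d₀) d₂))
    preserves ⟨10⟩ 0≤ = rescale (γ P) (-K (+-closed (*-closed 2∈K x∈K) y∈K) 1∈K) y∈K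
      (+-closed x∈K y∈K)
      (x≤y∧x≉y⇒x<y 0≤ (λ eq → 2x+y-1≉0 (≈-sym eq))) (0<β P) (0<γ P)
      (solve 3 (λ o x y → x :+ y := (con 2ℚ :* x :+ y :- o) :+ y :+ (o :- x :- y))
             ≈-refl 1# x y)
      (λ a eq → let (d₀ , d₁ , d₂) = weights (-‿homo (a 1F))
                      (ι[a+bc] (a 0F) (a 1F) (a 1F)) (ι[a+bc] (a 0F) (a 1F) (a 2F))
                      (solve 6 (λ a b c o x y →
                          (:- b) :* o :+ (a :+ (b :+ b)) :* x :+ (a :+ (b :+ c)) :* y
                          := a :* (x :+ y) :+ b :* (con 2ℚ :* x :+ y :- o) :+ c :* y)
                         ≈-refl _ _ _ 1# x y) eq
                    b≡0 = 0neg d₀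
                    a≡0 = +0 (sum0 b≡0 b≡0) d₁
                in all-zero a≡0 b≡0 (0+ b≡0 (0+ a≡0 d₂)))
    preserves ⟨20⟩ 0≤ = rescale (γ P) x∈K (-K (+-closed x∈K (*-closed 2∈K y∈K)) 1∈K)
      (+-closed x∈K y∈K)
      (0<α P) (x≤y∧x≉y⇒x<y 0≤ (λ eq → x+2y-1≉0 (≈-sym eq))) (0<γ P)
      (solve 3 (λ o x y → x :+ y := x :+ (x :+ con 2ℚ :* y :- o) :+ (o :- x :- y))
             ≈-refl 1# x y)
      (λ a eq → let (d₀ , d₁ , d₂) = weights (-‿homo (a 2F))
                      (ι[a+bc] (a 0F) (a 1F) (a 2F)) (ι[a+bc] (a 0F) (a 2F) (a 2F))
                      (solve 6 (λ a b c o x y →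
                          (:- c) :* o :+ (a :+ (b :+ c)) :* x :+ (a :+ (c :+ c)) :* y
                          := a :* (x :+ y) :+ b :* x :+ c :* (x :+ con 2ℚ :* y :- o))
                         ≈-refl _ _ _ 1# x y) eq
                    c≡0 = 0neg d₀
                    a≡0 = +0 (sum0 c≡0 c≡0) d₂
                in all-zero a≡0 (+0 c≡0 (0+ a≡0 d₁)) c≡0)

  T : ΔK → ΔK
  T P = record
    { α    = proj₁ (T⟨ ε P ⟩ (point P))
    ; β    = proj₂ (T⟨ ε P ⟩ (point P))
    ; inΔK = Preservation.preserves P (ε P) (ε∈△ P)
    }

  εₙ : ΔK → ℕ → Ind
  εₙ P n = ε (fold P T n)

{-# OPTIONS --safe #-}
module Submission where

open import Defs
import Algebra.Properties.CommutativeSemiring.Exp as Exp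
import Algebra.Properties.Group as GroupProperties
import Algebra.Properties.Semiring.Mult as Mult
open import Data.Empty using (⊥)
open import Data.Fin.Base using (Fin; zero; suc)
open import Data.Fin.Patterns using (0F; 1F; 2F)
open import Data.Fin.Properties as Fin using (all?)
open import Data.Integer.Base as ℤ using (+_; -[1+_])
import Data.Integer.Properties as ℤ
open import Data.Nat.Base as ℕ using (zero; suc)
import Data.Nat.DivMod as ℕ
open import Data.Nat.GeneralisedArithmetic using (fold)
import Data.Nat.Properties as ℕ
open import Data.Product.Base using (∃; _×_; _,_; proj₁; proj₂)
open import Data.Rational.Base as ℚ using (ℚ; 0ℚ; 1ℚ; mkℚ)
import Data.Rational.Properties as ℚ
open import Data.Rational.Solver using (module +-*-Solver)
open import Data.Rational.Unnormalised.Base using (mkℚᵘ; *≡*)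
import Data.Rational.Unnormalised.Properties as ℚᵘ
open import Data.Sum.Base using (_⊎_; inj₁; inj₂; [_,_]′; swap)
open import Data.Vec.Functional using (Vector)
open import Level using (_⊔_)
open import Relation.Binary.Bundles using (StrictPartialOrder)
open import Relation.Binary.Definitions using (tri<; tri≈; tri>)
open import Relation.Binary.PropositionalEquality as ≡ using (_≢_; refl)
import Relation.Binary.Reasoning.StrictPartialOrder as StrictReasoning
open import Relation.Binary.Structures using (IsStrictTotalOrder)
open import Relation.Nullary using (Dec; yes; no; contradiction)
open import Relation.Nullary.Decidable using (from-yes; ¬?; _→-dec_; _×-dec_; _⊎-dec_)
open import Relation.Unary using (_∈_)

open import Data.Nat using (ℕ; NonZero)
open import Data.Nat.Coprimality using (Coprime)
open import Data.Nat.Divisibility using (_∣_)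
open import Relation.Binary.PropositionalEquality using (_≡_)
open import Relation.Nullary using (¬_)

-- Write y = (y₀ , y₁ , y₂) for (γ , α , β) carried along without normalisation, so
-- that the step (i , j) replaces yᵢ by yᵢ - yⱼ.  The product A over a period has a
-- positive diagonal and a positive entry (i , j) for every step that occurs, and
-- A² is positive once every index occurs both as a first and as a second entry.
--
-- If k is never a first entry, then y_k is constant.  A step (i , k) subtracts y_k,
-- and a step (i , j) with j ≠ k is chosen over (i , k), so that
-- y_kᵖ |N(y_j)|^q ≤ y_jᵖ |N(y_k)|^q; since |N| has a positive minimum on the nonzero
-- elements of ℤα + ℤβ + ℤγ, this bounds y_j from below.  So the sum of y decreases by a fixed
-- amount in each step, contradicting positivity.
--
-- If k is never a second entry, then the other two coordinates (s , t) evolve on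
-- their own, by a positive 2 × 2 block of A.  The Wronskian of (s , t) at times n
-- and n + l does not depend on n and tends to 0, so it vanishes, and s / t is a root of
-- a rational quadratic equation.  A cubic field has no quadratic irrationals,
-- so s and t are linearly dependent over ℚ, contradicting the independence of 1, α, β.

-- Ordered fields

module OrderedField {c ℓ₁ ℓ₂} (R : RealField c ℓ₁ ℓ₂) where
  open RealField R
  open RealFieldProperties R
  open Solver using (solve; _:=_; _:+_; _:*_; _:-_; :-_; con)
  open Mult semiring using (×-homo-+; ×1-homo-*)
  open Exp commutativeSemiring public using (^-distrib-*; ^-congˡ)

  strictPartialOrder : StrictPartialOrder c ℓ₁ ℓ₂
  strictPartialOrder = record
    { isStrictPartialOrder = IsStrictTotalOrder.isStrictPartialOrder isStrictTotalOrder }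

  module ≤-Reasoning = StrictReasoning strictPartialOrder
  open ≤-Reasoning

  <-≤-trans : ∀ {x y z} → x < y → y ≤ z → x < z
  <-≤-trans x<y (inj₁ y<z) = <-trans x<y y<z
  <-≤-trans x<y (inj₂ y≈z) = <-respʳ-≈ y≈z x<y

  ≤⇒≯ : ∀ {x y} → x ≤ y → ¬ (y < x)
  ≤⇒≯ x≤y y<x = <-irrefl ≈-refl (<-≤-trans y<x x≤y)

  +-monoˡ-≤ : ∀ {x y} z → x ≤ y → x + z ≤ y + z
  +-monoˡ-≤ z (inj₁ x<y) = inj₁ (+-monoˡ-< z x<y)
  +-monoˡ-≤ z (inj₂ x≈y) = inj₂ (+-congʳ x≈y)

  +-monoʳ-≤ : ∀ {x y} z → x ≤ y → z + x ≤ z + y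
  +-monoʳ-≤ {x} {y} z x≤y = begin
    z + x  ≈⟨ +-comm z x ⟩
    x + z  ≤⟨ +-monoˡ-≤ z x≤y ⟩
    y + z  ≈⟨ +-comm y z ⟩
    z + y  ∎

  +-mono-≤ : ∀ {x y z w} → x ≤ y → z ≤ w → x + z ≤ y + w
  +-mono-≤ {y = y} {z} x≤y z≤w = ≤-trans (+-monoˡ-≤ z x≤y) (+-monoʳ-≤ y z≤w)

  x≤x+y : ∀ {x y} → 0# ≤ y → x ≤ x + y
  x≤x+y {x} {y} 0≤y = begin
    x       ≈⟨ +-identityʳ x ⟨
    x + 0#  ≤⟨ +-monoʳ-≤ x 0≤y ⟩
    x + y   ∎

  *-monoˡ-< : ∀ {x y z} → 0# < z → x < y → x * z < y * z
  *-monoˡ-< {x} {y} {z} 0<z x<y = 0<y-x⇒x<y (<-respʳ-≈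
    (solve 3 (λ x y z → (y :- x) :* z := y :* z :- x :* z) ≈-refl x y z)
    (*-pos (x<y⇒0<y-x x<y) 0<z))

  *-monoˡ-≤ : ∀ {x y z} → 0# < z → x ≤ y → x * z ≤ y * z
  *-monoˡ-≤ 0<z (inj₁ x<y) = inj₁ (*-monoˡ-< 0<z x<y)
  *-monoˡ-≤ 0<z (inj₂ x≈y) = inj₂ (*-congʳ x≈y)

  *-cancelʳ-≤ : ∀ {x y z} → 0# < z → x * z ≤ y * z → x ≤ y
  *-cancelʳ-≤ {x} {y} 0<z xz≤yz with compare x y
  ... | tri< x<y _ _ = inj₁ x<y
  ... | tri≈ _ x≈y _ = inj₂ x≈y
  ... | tri> _ _ y<x = contradiction (*-monoˡ-< 0<z y<x) (≤⇒≯ xz≤yz)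

  *-mono-≤ : ∀ {x y z w} → 0# < y → 0# < z → x ≤ y → z ≤ w → x * z ≤ y * w
  *-mono-≤ {x} {y} {z} {w} 0<y 0<z x≤y z≤w = begin
    x * z  ≤⟨ *-monoˡ-≤ 0<z x≤y ⟩
    y * z  ≈⟨ *-comm y z ⟩
    z * y  ≤⟨ *-monoˡ-≤ 0<y z≤w ⟩
    w * y  ≈⟨ *-comm w y ⟩
    y * w  ∎

  *-cancelʳ-≈ : ∀ {x y z} → 0# < z → x * z ≈ y * z → x ≈ y
  *-cancelʳ-≈ {x} {y} 0<z xz≈yz with compare x y
  ... | tri< x<y _ _ = contradiction (*-monoˡ-< 0<z x<y) (≤⇒≯ (inj₂ (≈-sym xz≈yz)))
  ... | tri≈ _ x≈y _ = x≈y
  ... | tri> _ _ y<x = contradiction (*-monoˡ-< 0<z y<x) (≤⇒≯ (inj₂ xz≈yz))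

  x*y≈0⇒x≈0 : ∀ {x y} → ¬ (y ≈ 0#) → x * y ≈ 0# → x ≈ 0#
  x*y≈0⇒x≈0 {x} {y} y≉0 xy≈0 = begin-equality
    x               ≈⟨ *-identityʳ x ⟨
    x * 1#          ≈⟨ *-congˡ (⁻¹-inverseʳ y≉0) ⟨
    x * (y * y ⁻¹)  ≈⟨ *-assoc x y (y ⁻¹) ⟨
    x * y * y ⁻¹    ≈⟨ *-congʳ xy≈0 ⟩
    0# * y ⁻¹       ≈⟨ zeroˡ _ ⟩
    0#              ∎

  x*x≈0⇒x≈0 : ∀ {x} → x * x ≈ 0# → x ≈ 0#
  x*x≈0⇒x≈0 {x} xx≈0 with x ≟ 0#
  ... | yes x≈0 = x≈0
  ... | no  x≉0 = x*y≈0⇒x≈0 x≉0 xx≈0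

  x/y*y≈x : ∀ {x y} → ¬ (y ≈ 0#) → x / y * y ≈ x
  x/y*y≈x {x} {y} y≉0 = begin-equality
    x * y ⁻¹ * y     ≈⟨ solve 3 (λ x y i → x :* i :* y := x :* (y :* i)) ≈-refl x y (y ⁻¹) ⟩
    x * (y * y ⁻¹)   ≈⟨ *-congˡ (⁻¹-inverseʳ y≉0) ⟩
    x * 1#           ≈⟨ *-identityʳ x ⟩
    x                ∎

  x-y≈0⇒x≈y : ∀ {x y} → x - y ≈ 0# → x ≈ y
  x-y≈0⇒x≈y {x} {y} eq = begin-equality
    x            ≈⟨ solve 2 (λ x y → x := (x :- y) :+ y) ≈-refl x y ⟩
    x - y + y    ≈⟨ +-congʳ eq ⟩
    0# + y       ≈⟨ +-identityˡ y ⟩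
    y            ∎

  x²≈y²⇒x≈±y : ∀ {x y} → x * x ≈ y * y → (x ≈ y) ⊎ (x ≈ - y)
  x²≈y²⇒x≈±y {x} {y} eq with x + y ≟ 0#
  ... | yes x+y≈0 = inj₂ (x-y≈0⇒x≈y (≈-trans
    (solve 2 (λ x y → x :- (:- y) := x :+ y) ≈-refl x y) x+y≈0))
  ... | no  x+y≉0 = inj₁ (x-y≈0⇒x≈y (x*y≈0⇒x≈0 x+y≉0 (≈-trans
    (solve 2 (λ x y → (x :- y) :* (x :+ y) := x :* x :- y :* y) ≈-refl x y)
    (≈-trans (+-congʳ eq) (-‿inverseʳ _)))))

  ^-monoˡ-≤ : ∀ n {x y} → 0# < x → x ≤ y → x ^ n ≤ y ^ n
  ^-monoˡ-≤ zero    0<x x≤y = ≤-refl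
  ^-monoˡ-≤ (suc n) 0<x x≤y = *-mono-≤ (<-≤-trans 0<x x≤y) (^-pos n 0<x) x≤y (^-monoˡ-≤ n 0<x x≤y)

  1^n≈1 : ∀ n → 1# ^ n ≈ 1#
  1^n≈1 zero    = ≈-refl
  1^n≈1 (suc n) = ≈-trans (*-identityˡ _) (1^n≈1 n)

  x≤1⇒x^n≤x : ∀ n .{{_ : NonZero n}} {x} → 0# < x → x ≤ 1# → x ^ n ≤ x
  x≤1⇒x^n≤x (suc n) {x} 0<x x≤1 = begin
    x * x ^ n   ≈⟨ *-comm x _ ⟩
    x ^ n * x   ≤⟨ *-monoˡ-≤ 0<x (^-monoˡ-≤ n 0<x x≤1) ⟩
    1# ^ n * x  ≈⟨ *-congʳ (1^n≈1 n) ⟩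
    1# * x      ≈⟨ *-identityˡ x ⟩
    x           ∎

  positiveLowerBound : ∀ {x y} → 0# < x → 0# < y → ∃ λ δ → (0# < δ) × (δ ≤ x) × (δ ≤ y)
  positiveLowerBound {x} {y} 0<x 0<y with x ≤? y
  ... | yes x≤y = x , 0<x , ≤-refl , x≤y
  ... | no  x≰y = y , 0<y , ≰⇒≥ x≰y , ≤-refl

  *-cancelʳ-pos : ∀ {x y} → 0# < y → 0# < x * y → 0# < x
  *-cancelʳ-pos {x} {y} 0<y 0<xy with x ≤? 0#
  ... | yes x≤0 = contradiction 0<xy (≤⇒≯ (≤-trans (*-monoˡ-≤ 0<y x≤0) (inj₂ (zeroˡ y))))
  ... | no  x≰0 = x≤y∧x≉y⇒x<y (≰⇒≥ x≰0) (λ 0≈x → x≰0 (inj₂ (≈-sym 0≈x)))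

  ·-pos : ∀ n .{{_ : NonZero n}} {x} → 0# < x → 0# < n · x
  ·-pos (suc zero)      0<x = <-respʳ-≈ (≈-sym (+-identityʳ _)) 0<x
  ·-pos (suc (suc n)) 0<x = +-pos 0<x (·-pos (suc n) 0<x)

  0≤n·1 : ∀ n → 0# ≤ n · 1#
  0≤n·1 zero    = ≤-refl
  0≤n·1 (suc n) = inj₁ (·-pos (suc n) 0<1)

  -- After n steps at least n times δ has been lost from `f 0`, and by the Archimedean property some
  -- such multiple exceeds `f 0`, which forces a negative value. This replaces every appeal to
  -- limits.
  ¬-infinite-descent : ∀ (f : ℕ → Carrier) {δ} → 0# < δ → (∀ n → 0# < f n) →
                       (∀ n → f (suc n) + δ ≤ f n) → ⊥
  ¬-infinite-descent f {δ} 0<δ 0<f step = ≤⇒≯ (bound n) (<-trans f₀<nδ nδ<)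
    where
    n = proj₁ (archimedean δ (f 0) 0<δ)
    f₀<nδ = proj₂ (archimedean δ (f 0) 0<δ)
    nδ< : n · δ < f n + n · δ
    nδ< = <-respˡ-≈ (+-identityˡ _) (+-monoˡ-< (n · δ) (0<f n))
    bound : ∀ n → f n + n · δ ≤ f 0
    bound zero    = inj₂ (+-identityʳ _)
    bound (suc n) = begin
      f (suc n) + (δ + n · δ)  ≈⟨ +-assoc _ _ _ ⟨
      f (suc n) + δ + n · δ    ≤⟨ +-monoˡ-≤ (n · δ) (step n) ⟩
      f n + n · δ              ≤⟨ bound n ⟩
      f 0                      ∎

  -- The rational integers inside the field, presented as differences of natural multiples of `1#`,
  -- so that sign questions become comparisons in ℕ.
  record Integral (x : Carrier) : Set ℓ₁ where
    constructor integral
    field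
      m n : ℕ
      x≈m-n : x ≈ m · 1# - n · 1#

  integral-resp : ∀ {x y} → x ≈ y → Integral x → Integral y
  integral-resp x≈y (integral m n eq) = integral m n (≈-trans (≈-sym x≈y) eq)

  integral-+ : ∀ {x y} → Integral x → Integral y → Integral (x + y)
  integral-+ {x} {y} (integral m n p) (integral m′ n′ q) = integral (m ℕ.+ m′) (n ℕ.+ n′)
    (begin-equality
      x + y
        ≈⟨ +-cong p q ⟩
      m · 1# - n · 1# + (m′ · 1# - n′ · 1#)
        ≈⟨ solve 4 (λ m n m′ n′ → m :- n :+ (m′ :- n′) := m :+ m′ :- (n :+ n′)) ≈-refl _ _ _ _ ⟩
      m · 1# + m′ · 1# - (n · 1# + n′ · 1#)
        ≈⟨ +-cong (×-homo-+ 1# m m′) (-‿cong (×-homo-+ 1# n n′)) ⟨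
      (m ℕ.+ m′) · 1# - (n ℕ.+ n′) · 1# ∎)

  integral-neg : ∀ {x} → Integral x → Integral (- x)
  integral-neg (integral m n p) = integral n m (≈-trans (-‿cong p)
    (solve 2 (λ m n → :- (m :- n) := n :- m) ≈-refl (m · 1#) (n · 1#)))

  integral-* : ∀ {x y} → Integral x → Integral y → Integral (x * y)
  integral-* {x} {y} (integral m n p) (integral m′ n′ q) =
    integral (m ℕ.* m′ ℕ.+ n ℕ.* n′) (m ℕ.* n′ ℕ.+ n ℕ.* m′) (begin-equality
      x * y
        ≈⟨ *-cong p q ⟩
      (m · 1# - n · 1#) * (m′ · 1# - n′ · 1#)
        ≈⟨ solve 4 (λ m n m′ n′ → (m :- n) :* (m′ :- n′)
             := m :* m′ :+ n :* n′ :- (m :* n′ :+ n :* m′)) ≈-refl _ _ _ _ ⟩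
      (m · 1#) * (m′ · 1#) + (n · 1#) * (n′ · 1#) - ((m · 1#) * (n′ · 1#) + (n · 1#) * (m′ · 1#))
        ≈⟨ +-cong (sum-of-products m m′ n n′) (-‿cong (sum-of-products m n′ n m′)) ⟨
      (m ℕ.* m′ ℕ.+ n ℕ.* n′) · 1# - (m ℕ.* n′ ℕ.+ n ℕ.* m′) · 1# ∎)
    where
    sum-of-products : ∀ a b c d →
      (a ℕ.* b ℕ.+ c ℕ.* d) · 1# ≈ (a · 1#) * (b · 1#) + (c · 1#) * (d · 1#)
    sum-of-products a b c d = ≈-trans (×-homo-+ 1# (a ℕ.* b) (c ℕ.* d))
                                      (+-cong (×1-homo-* a b) (×1-homo-* c d))

  -- Discreteness of the integers: if m ≤ n, the difference m - n is not positive; otherwise m is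
  -- `suc n` plus some k, and the difference is 1 + k.
  positive-integral⇒1≤ : ∀ {x} → Integral x → 0# < x → 1# ≤ x
  positive-integral⇒1≤ {x} (integral m n p) 0<x with m ℕ.≤? n
  ... | yes m≤n = contradiction 0<x (≤⇒≯ (begin
    x                                   ≈⟨ p ⟩
    m · 1# - n · 1#                     ≤⟨ +-monoˡ-≤ _ (x≤x+y (0≤n·1 (n ℕ.∸ m))) ⟩
    m · 1# + (n ℕ.∸ m) · 1# - n · 1#    ≈⟨ +-congʳ (×-homo-+ 1# m (n ℕ.∸ m)) ⟨
    (m ℕ.+ (n ℕ.∸ m)) · 1# - n · 1#     ≡⟨ ≡.cong (λ k → k · 1# - n · 1#) (ℕ.m+[n∸m]≡n m≤n) ⟩
    n · 1# - n · 1#                     ≈⟨ -‿inverseʳ _ ⟩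
    0#                                  ∎))
  ... | no  m≰n = begin
    1#                                         ≤⟨ x≤x+y (0≤n·1 k) ⟩
    1# + k · 1#                                ≈⟨ solve 3 (λ o k n → o :+ k := o :+ (n :+ k) :- n)
                                                    ≈-refl 1# (k · 1#) (n · 1#) ⟩
    1# + (n · 1# + k · 1#) - n · 1#            ≈⟨ +-congʳ (+-congˡ (×-homo-+ 1# n k)) ⟨
    suc (n ℕ.+ k) · 1# - n · 1#                ≡⟨ ≡.cong (λ j → j · 1# - n · 1#)
                                                    (ℕ.m+[n∸m]≡n (ℕ.≰⇒> m≰n)) ⟩
    m · 1# - n · 1#                            ≈⟨ p ⟨
    x                                          ∎
    where
    k = m ℕ.∸ suc n

  -- The embedding of ℚ and clearing denominators

  ι[n/1] : ∀ n → ι (+ n ℚ./ 1) ≈ n · 1#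
  ι[n/1] zero    = 0#-homo
  ι[n/1] (suc n) = begin-equality
    ι (+ suc n ℚ./ 1)         ≡⟨ ≡.cong ι 1+[n/1] ⟩
    ι (ℚ.1ℚ ℚ.+ + n ℚ./ 1)    ≈⟨ +-homo _ _ ⟩
    ι ℚ.1ℚ + ι (+ n ℚ./ 1)    ≈⟨ +-cong 1#-homo (ι[n/1] n) ⟩
    1# + n · 1#               ∎
    where
    1+[n/1] : + suc n ℚ./ 1 ≡ ℚ.1ℚ ℚ.+ + n ℚ./ 1
    -- `ℚ./` divides by a gcd that does not reduce for a variable n, so the equation is checked
    -- among unnormalised rationals.
    1+[n/1] = ℚ.toℚᵘ-injective (ℚᵘ.≃-trans (ℚ.toℚᵘ-fromℚᵘ (mkℚᵘ (+ suc n) 0))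
      (ℚᵘ.≃-trans
        (*≡* (≡.cong (λ k → (+ 1 ℤ.+ k) ℤ.* + 1) (≡.sym (ℤ.*-identityʳ (+ n)))))
        (ℚᵘ.≃-sym (ℚᵘ.≃-trans (ℚ.toℚᵘ-homo-+ ℚ.1ℚ (+ n ℚ./ 1))
          (ℚᵘ.+-congʳ (ℚ.toℚᵘ ℚ.1ℚ) (ℚ.toℚᵘ-fromℚᵘ (mkℚᵘ (+ n) 0)))))))

  ι-clearDenominator : ∀ q → ι q * (ℚ.↧ₙ q · 1#) ≈ ι (ℚ.↥ q ℚ./ 1)
  ι-clearDenominator q@(mkℚ n d _) = begin-equality
    ι q * (suc d · 1#)          ≈⟨ *-congˡ (ι[n/1] (suc d)) ⟨
    ι q * ι (+ suc d ℚ./ 1)     ≈⟨ *-homo _ _ ⟨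
    ι (q ℚ.* (+ suc d ℚ./ 1))   ≡⟨ ≡.cong ι (ℚ.toℚᵘ-injective (ℚᵘ.≃-trans
                                     (ℚ.toℚᵘ-homo-* q (+ suc d ℚ./ 1)) (ℚᵘ.≃-trans
                                     (ℚᵘ.*-congˡ {ℚ.toℚᵘ q} (ℚ.toℚᵘ-fromℚᵘ (mkℚᵘ (+ suc d) 0)))
                                     (ℚᵘ.≃-trans (*≡* eq)
                                     (ℚᵘ.≃-sym (ℚ.toℚᵘ-fromℚᵘ (mkℚᵘ n 0))))))) ⟩
    ι (n ℚ./ 1)                 ∎
    where
    eq : n ℤ.* + suc d ℤ.* + 1 ≡ n ℤ.* + (suc d ℕ.* 1)
    eq = ≡.trans (ℤ.*-identityʳ _) (≡.cong (λ k → n ℤ.* + k) (≡.sym (ℕ.*-identityʳ (suc d))))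

  ι-integral : ∀ n → Integral (ι (n ℚ./ 1))
  ι-integral (+ n)    = integral n 0 (≈-trans (ι[n/1] n)
    (≈-trans (≈-sym (+-identityʳ _)) (+-congˡ (≈-trans (≈-sym (-‿inverseʳ 0#)) (+-identityˡ _)))))
  ι-integral -[1+ n ] = integral-resp (≈-sym (-‿homo _)) (integral-neg (ι-integral (+ suc n)))

  integral-ℕ : ∀ n → Integral (n · 1#)
  integral-ℕ n = integral-resp (ι[n/1] n) (ι-integral (+ n))

  -- `ι` is given as a ring homomorphism only, so its positivity is derived: multiplied by the
  -- denominator, the value is a positive natural multiple of `1#`.
  ι∣q∣-pos : ∀ {q} → ¬ (q ≡ 0ℚ) → 0# < ι ℚ.∣ q ∣
  ι∣q∣-pos {mkℚ (+ zero) d c}    q≢0 = contradiction (ℚ.↥p≡0⇒p≡0 (mkℚ (+ zero) d c) refl) q≢0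
  ι∣q∣-pos {q@(mkℚ (+ suc n) d _)} _ = *-cancelʳ-pos (·-pos (suc d) 0<1)
    (<-respʳ-≈ (≈-sym (≈-trans (ι-clearDenominator ℚ.∣ q ∣) (ι[n/1] (suc n)))) (·-pos (suc n) 0<1))
  ι∣q∣-pos {q@(mkℚ -[1+ n ] d _)}  _ = *-cancelʳ-pos (·-pos (suc d) 0<1)
    (<-respʳ-≈ (≈-sym (≈-trans (ι-clearDenominator ℚ.∣ q ∣) (ι[n/1] (suc n)))) (·-pos (suc n) 0<1))

  ι-sub : ∀ p q → ι (p ℚ.- q) ≈ ι p - ι q
  ι-sub p q = ≈-trans (+-homo _ _) (+-congˡ (-‿homo _))

  ι∣q∣≈±ιq : ∀ q → (ι ℚ.∣ q ∣ ≈ ι q) ⊎ (ι ℚ.∣ q ∣ ≈ - ι q)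
  ι∣q∣≈±ιq q with ℚ.∣p∣≡p∨∣p∣≡-p q
  ... | inj₁ eq = inj₁ (⟦⟧-cong eq)
  ... | inj₂ eq = inj₂ (≈-trans (⟦⟧-cong eq) (-‿homo q))

  integral-multiple : ∀ q → ∃ λ n → (0 ℕ.< n) × Integral (n · 1# * ι q)
  integral-multiple q = ℚ.↧ₙ q , ℕ.>-nonZero⁻¹ (ℚ.↧ₙ q) ,
    integral-resp (≈-trans (≈-sym (ι-clearDenominator q)) (*-comm _ _)) (ι-integral (ℚ.↥ q))

  integral-scale : ∀ k {n x} → Integral (n · 1# * x) → Integral ((k ℕ.* n) · 1# * x)
  integral-scale k {n} {x} int = integral-resp
    (≈-trans (≈-sym (*-assoc _ _ _)) (*-congʳ (≈-sym (×1-homo-* k n))))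
    (integral-* (integral-ℕ k) int)

-- The product of the individual witnesses serves all indices at once, because each `P i` is stable
-- under passing to multiples.
commonMultiple : ∀ {a m} (P : Fin m → ℕ → Set a) → (∀ i k {n} → P i n → P i (k ℕ.* n)) →
                 (∀ i → ∃ λ n → (0 ℕ.< n) × P i n) → ∃ λ n → (0 ℕ.< n) × (∀ i → P i n)
commonMultiple {m = zero}  P scale h = 1 , ℕ.s≤s ℕ.z≤n , λ ()
commonMultiple {m = suc m} P scale h
  with k , 0<k , p₀ ← h zero
     | n , 0<n , ps ← commonMultiple (λ i → P (suc i)) (λ i → scale (suc i)) (λ i → h (suc i))
  = n ℕ.* k , ℕ.*-mono-< 0<n 0<k , λ where
      zero    → scale zero n p₀
      (suc i) → ≡.subst (P (suc i)) (ℕ.*-comm k n) (scale (suc i) k (ps i))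

-- The norm of a cubic field

p-q≡0⇒p≡q : ∀ {p q} → p ℚ.- q ≡ 0ℚ → p ≡ q
p-q≡0⇒p≡q = GroupProperties.x∙y⁻¹≈ε⇒x≈y ℚ.+-0-group _ _

-- Expanded along the first row exactly as in `norm`, so that `norm` is definitionally the
-- determinant of the multiplication matrix.
det₃ : (a b c d e f g h i : ℚ) → ℚ
det₃ a b c d e f g h i =
  a ℚ.* (e ℚ.* i ℚ.- f ℚ.* h) ℚ.- b ℚ.* (d ℚ.* i ℚ.- f ℚ.* g) ℚ.+ c ℚ.* (d ℚ.* h ℚ.- e ℚ.* g)

module _ where
  open +-*-Solver using (Polynomial; solve; _:=_; _:+_; _:*_; _:-_)

  private
    :det₃ : ∀ {n} (a b c d e f g h i : Polynomial n) → Polynomial n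
    :det₃ a b c d e f g h i =
      a :* (e :* i :- f :* h) :- b :* (d :* i :- f :* g) :+ c :* (d :* h :- e :* g)

    infixr 5 _∙_
    _∙_ : ℚ × ℚ × ℚ → ℚ × ℚ × ℚ → ℚ
    (a , b , c) ∙ (x , y , z) = a ℚ.* x ℚ.+ (b ℚ.* y ℚ.+ c ℚ.* z)

    _:∙_ : ∀ {n} → Polynomial n × Polynomial n × Polynomial n →
           Polynomial n × Polynomial n × Polynomial n → Polynomial n
    (a , b , c) :∙ (x , y , z) = a :* x :+ (b :* y :+ c :* z)

  -- Multiplicativity of the determinant, as a polynomial identity in the eighteen entries that the
  -- ring solver decides.
  det₃-* : ∀ a b c d e f g h i a′ b′ c′ d′ e′ f′ g′ h′ i′ →
    det₃ ((a , b , c) ∙ (a′ , d′ , g′)) ((a , b , c) ∙ (b′ , e′ , h′)) ((a , b , c) ∙ (c′ , f′ , i′))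
         ((d , e , f) ∙ (a′ , d′ , g′)) ((d , e , f) ∙ (b′ , e′ , h′)) ((d , e , f) ∙ (c′ , f′ , i′))
         ((g , h , i) ∙ (a′ , d′ , g′)) ((g , h , i) ∙ (b′ , e′ , h′)) ((g , h , i) ∙ (c′ , f′ , i′))
    ≡ det₃ a b c d e f g h i ℚ.* det₃ a′ b′ c′ d′ e′ f′ g′ h′ i′
  det₃-* = solve 18 (λ a b c d e f g h i a′ b′ c′ d′ e′ f′ g′ h′ i′ →
    :det₃
      ((a , b , c) :∙ (a′ , d′ , g′)) ((a , b , c) :∙ (b′ , e′ , h′)) ((a , b , c) :∙ (c′ , f′ , i′))
      ((d , e , f) :∙ (a′ , d′ , g′)) ((d , e , f) :∙ (b′ , e′ , h′)) ((d , e , f) :∙ (c′ , f′ , i′))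
      ((g , h , i) :∙ (a′ , d′ , g′)) ((g , h , i) :∙ (b′ , e′ , h′)) ((g , h , i) :∙ (c′ , f′ , i′))
    := :det₃ a b c d e f g h i :* :det₃ a′ b′ c′ d′ e′ f′ g′ h′ i′) refl

  det₃-scale : ∀ q a b c d e f g h i →
    det₃ (q ℚ.* a) (q ℚ.* b) (q ℚ.* c) (q ℚ.* d) (q ℚ.* e) (q ℚ.* f) (q ℚ.* g) (q ℚ.* h) (q ℚ.* i)
    ≡ q ℚ.* q ℚ.* q ℚ.* det₃ a b c d e f g h i
  det₃-scale = solve 10 (λ q a b c d e f g h i →
    :det₃ (q :* a) (q :* b) (q :* c) (q :* d) (q :* e) (q :* f) (q :* g) (q :* h) (q :* i)
    := q :* q :* q :* :det₃ a b c d e f g h i) refl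

det : (Fin 3 → Fin 3 → ℚ) → ℚ
det A = det₃ (A 0F 0F) (A 0F 1F) (A 0F 2F) (A 1F 0F) (A 1F 1F) (A 1F 2F) (A 2F 0F) (A 2F 1F) (A 2F 2F)

det-cong : ∀ {A B} → (∀ i j → A i j ≡ B i j) → det A ≡ det B
det-cong eq rewrite eq 0F 0F | eq 0F 1F | eq 0F 2F | eq 1F 0F | eq 1F 1F | eq 1F 2F
                  | eq 2F 0F | eq 2F 1F | eq 2F 2F = refl

module Norm {c ℓ₁ ℓ₂ k} (R : RealField c ℓ₁ ℓ₂) (F : CubicField R k) where
  open RealField R
  open RealFieldProperties R
  open CubicField F
  open OrderedField R
  open Solver using (solve; _:=_; _:+_; _:*_; _:-_; :-_; con)
  open ≤-Reasoning

  span : Vector ℚ 3 → Carrier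
  span a = ι (a 0F) * basis 0F + (ι (a 1F) * basis 1F + ι (a 2F) * basis 2F)

  sum≈span : ∀ a → sum (λ i → ι (a i) * basis i) ≈ span a
  sum≈span a = +-congˡ (+-congˡ (+-identityʳ _))

  span-sub : ∀ a b → span (λ i → a i ℚ.- b i) ≈ span a - span b
  span-sub a b = ≈-trans (+-cong (*-congʳ (hom 0F)) (+-cong (*-congʳ (hom 1F)) (*-congʳ (hom 2F))))
    (solve 9 (λ x y z u v w a b c →
       (x :- u) :* a :+ ((y :- v) :* b :+ (z :- w) :* c)
       := (x :* a :+ (y :* b :+ z :* c)) :- (u :* a :+ (v :* b :+ w :* c))) ≈-refl
       (ι (a 0F)) (ι (a 1F)) (ι (a 2F)) (ι (b 0F)) (ι (b 1F)) (ι (b 2F))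
       (basis 0F) (basis 1F) (basis 2F))
    where
    hom : ∀ i → ι (a i ℚ.- b i) ≈ ι (a i) - ι (b i)
    hom i = ι-sub (a i) (b i)

  span-scale : ∀ q a → span (λ i → q ℚ.* a i) ≈ ι q * span a
  span-scale q a = ≈-trans
    (+-cong (*-congʳ (*-homo _ _)) (+-cong (*-congʳ (*-homo _ _)) (*-congʳ (*-homo _ _))))
    (solve 7 (λ q x y z a b c → q :* x :* a :+ (q :* y :* b :+ q :* z :* c)
       := q :* (x :* a :+ (y :* b :+ z :* c))) ≈-refl
       (ι q) (ι (a 0F)) (ι (a 1F)) (ι (a 2F)) (basis 0F) (basis 1F) (basis 2F))

  coordinates-span : ∀ {x} (x∈K : x ∈ K) → x ≈ span (coordinates x∈K)
  coordinates-span x∈K = ≈-trans (proj₂ (basis-spans x∈K)) (sum≈span (coordinates x∈K))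

  -- The difference of two coordinate vectors of x is a linear relation among the basis elements.
  -- Hence coordinates, and with them the norm, depend neither on the membership proof nor on the
  -- choice made by `basis-spans`.
  coordinates-unique : ∀ {x} (x∈K : x ∈ K) a → x ≈ span a → ∀ i → coordinates x∈K i ≡ a i
  coordinates-unique {x} x∈K a x≈ i = p-q≡0⇒p≡q (basis-independent (λ i → coordinates x∈K i ℚ.- a i)
    (begin-equality
      sum (λ i → ι (coordinates x∈K i ℚ.- a i) * basis i)  ≈⟨ sum≈span (λ i → coordinates x∈K i ℚ.- a i) ⟩
      span (λ i → coordinates x∈K i ℚ.- a i)               ≈⟨ span-sub (coordinates x∈K) a ⟩
      span (coordinates x∈K) - span a                      ≈⟨ +-cong (coordinates-span x∈K) (-‿cong x≈) ⟨
      x - x                                                ≈⟨ -‿inverseʳ x ⟩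
      0#                                                   ∎) i)

  mulMatrix : ∀ {x} → x ∈ K → Fin 3 → Fin 3 → ℚ
  mulMatrix x∈K i j = coordinates (*-closed x∈K (basis∈K j)) i

  mulMatrix-span : ∀ {x} (x∈K : x ∈ K) j → x * basis j ≈ span (λ i → mulMatrix x∈K i j)
  mulMatrix-span x∈K j = coordinates-span (*-closed x∈K (basis∈K j))

  -- The rules for differences, multiples and products below reduce to this: it suffices to exhibit
  -- a matrix whose columns express the products with the basis.
  mulMatrix-unique : ∀ {x} (x∈K : x ∈ K) (A : Fin 3 → Fin 3 → ℚ) →
    (∀ j → x * basis j ≈ span (λ i → A i j)) → ∀ i j → mulMatrix x∈K i j ≡ A i j
  mulMatrix-unique x∈K A eq i j = coordinates-unique (*-closed x∈K (basis∈K j)) (λ i → A i j) (eq j) i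

  mulMatrix-cong : ∀ {x y} (x∈K : x ∈ K) (y∈K : y ∈ K) → x ≈ y →
                   ∀ i j → mulMatrix x∈K i j ≡ mulMatrix y∈K i j
  mulMatrix-cong x∈K y∈K x≈y = mulMatrix-unique x∈K _
    (λ j → ≈-trans (*-congʳ x≈y) (mulMatrix-span y∈K j))

  mulMatrix-sub : ∀ {x y z} (x∈K : x ∈ K) (y∈K : y ∈ K) (z∈K : z ∈ K) → z ≈ x - y →
                  ∀ i j → mulMatrix z∈K i j ≡ mulMatrix x∈K i j ℚ.- mulMatrix y∈K i j
  mulMatrix-sub {x} {y} {z} x∈K y∈K z∈K z≈x-y =
    mulMatrix-unique z∈K (λ i j → A i j ℚ.- B i j) λ j → begin-equality
    z * basis j                ≈⟨ *-congʳ z≈x-y ⟩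
    (x - y) * basis j          ≈⟨ solve 3 (λ x y b → (x :- y) :* b := x :* b :- y :* b) ≈-refl _ _ _ ⟩
    x * basis j - y * basis j  ≈⟨ +-cong (mulMatrix-span x∈K j) (-‿cong (mulMatrix-span y∈K j)) ⟩
    span (λ i → A i j) - span (λ i → B i j)
                               ≈⟨ span-sub (λ i → A i j) (λ i → B i j) ⟨
    span (λ i → A i j ℚ.- B i j) ∎
    where
    A B : Fin 3 → Fin 3 → ℚ
    A = mulMatrix x∈K
    B = mulMatrix y∈K

  mulMatrix-scale : ∀ {x z} (x∈K : x ∈ K) (z∈K : z ∈ K) q → z ≈ ι q * x →
                    ∀ i j → mulMatrix z∈K i j ≡ q ℚ.* mulMatrix x∈K i j
  mulMatrix-scale {x} {z} x∈K z∈K q z≈qx =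
    mulMatrix-unique z∈K (λ i j → q ℚ.* A i j) λ j → begin-equality
    z * basis j         ≈⟨ *-congʳ z≈qx ⟩
    ι q * x * basis j   ≈⟨ *-assoc _ _ _ ⟩
    ι q * (x * basis j) ≈⟨ *-congˡ (mulMatrix-span x∈K j) ⟩
    ι q * span (λ i → A i j)
                        ≈⟨ span-scale q (λ i → A i j) ⟨
    span (λ i → q ℚ.* A i j) ∎
    where
    A : Fin 3 → Fin 3 → ℚ
    A = mulMatrix x∈K

  mulMatrix-* : ∀ {x y z} (x∈K : x ∈ K) (y∈K : y ∈ K) (z∈K : z ∈ K) → z ≈ x * y →
    let A = mulMatrix x∈K; B = mulMatrix y∈K in
    ∀ i j → mulMatrix z∈K i j ≡ A i 0F ℚ.* B 0F j ℚ.+ (A i 1F ℚ.* B 1F j ℚ.+ A i 2F ℚ.* B 2F j)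
  mulMatrix-* {x} {y} {z} x∈K y∈K z∈K z≈xy = mulMatrix-unique z∈K _ λ j → begin-equality
    z * basis j
      ≈⟨ *-congʳ z≈xy ⟩
    x * y * basis j
      ≈⟨ *-assoc _ _ _ ⟩
    x * (y * basis j)
      ≈⟨ *-congˡ (mulMatrix-span y∈K j) ⟩
    x * (b 0F j * basis 0F + (b 1F j * basis 1F + b 2F j * basis 2F))
      ≈⟨ solve 7 (λ x p q r u v w → x :* (p :* u :+ (q :* v :+ r :* w))
           := x :* u :* p :+ (x :* v :* q :+ x :* w :* r)) ≈-refl _ _ _ _ _ _ _ ⟩
    x * basis 0F * b 0F j + (x * basis 1F * b 1F j + x * basis 2F * b 2F j)
      ≈⟨ +-cong (*-congʳ (mulMatrix-span x∈K 0F))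
           (+-cong (*-congʳ (mulMatrix-span x∈K 1F)) (*-congʳ (mulMatrix-span x∈K 2F))) ⟩
    span (λ i → A i 0F) * b 0F j + (span (λ i → A i 1F) * b 1F j + span (λ i → A i 2F) * b 2F j)
      ≈⟨ solve 15 (λ a₀₀ a₀₁ a₀₂ a₁₀ a₁₁ a₁₂ a₂₀ a₂₁ a₂₂ b₀ b₁ b₂ u v w →
           (a₀₀ :* u :+ (a₁₀ :* v :+ a₂₀ :* w)) :* b₀
           :+ ((a₀₁ :* u :+ (a₁₁ :* v :+ a₂₁ :* w)) :* b₁
           :+ (a₀₂ :* u :+ (a₁₂ :* v :+ a₂₂ :* w)) :* b₂)
           := (a₀₀ :* b₀ :+ (a₀₁ :* b₁ :+ a₀₂ :* b₂)) :* u
           :+ ((a₁₀ :* b₀ :+ (a₁₁ :* b₁ :+ a₁₂ :* b₂)) :* v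
           :+ (a₂₀ :* b₀ :+ (a₂₁ :* b₁ :+ a₂₂ :* b₂)) :* w)) ≈-refl
           (a 0F 0F) (a 0F 1F) (a 0F 2F) (a 1F 0F) (a 1F 1F) (a 1F 2F) (a 2F 0F) (a 2F 1F) (a 2F 2F)
           (b 0F j) (b 1F j) (b 2F j) (basis 0F) (basis 1F) (basis 2F) ⟩
    _
      ≈⟨ +-cong (*-congʳ (hom 0F j)) (+-cong (*-congʳ (hom 1F j)) (*-congʳ (hom 2F j))) ⟨
    span (λ i → A i 0F ℚ.* B 0F j ℚ.+ (A i 1F ℚ.* B 1F j ℚ.+ A i 2F ℚ.* B 2F j)) ∎
    where
    A B : Fin 3 → Fin 3 → ℚ
    A = mulMatrix x∈K
    B = mulMatrix y∈K
    a b : Fin 3 → Fin 3 → Carrier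
    a i j = ι (A i j)
    b i j = ι (B i j)
    hom : ∀ i j → ι (A i 0F ℚ.* B 0F j ℚ.+ (A i 1F ℚ.* B 1F j ℚ.+ A i 2F ℚ.* B 2F j))
                  ≈ a i 0F * b 0F j + (a i 1F * b 1F j + a i 2F * b 2F j)
    hom i j = ≈-trans (+-homo _ _) (+-cong (*-homo _ _)
                (≈-trans (+-homo _ _) (+-cong (*-homo _ _) (*-homo _ _))))

  norm-cong : ∀ {x y} (x∈K : x ∈ K) (y∈K : y ∈ K) → x ≈ y → norm x∈K ≡ norm y∈K
  norm-cong x∈K y∈K x≈y = det-cong (mulMatrix-cong x∈K y∈K x≈y)

  norm-* : ∀ {x y z} (x∈K : x ∈ K) (y∈K : y ∈ K) (z∈K : z ∈ K) → z ≈ x * y →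
           norm z∈K ≡ norm x∈K ℚ.* norm y∈K
  norm-* x∈K y∈K z∈K z≈xy = ≡.trans (det-cong (mulMatrix-* x∈K y∈K z∈K z≈xy))
    (det₃-* (A 0F 0F) (A 0F 1F) (A 0F 2F) (A 1F 0F) (A 1F 1F) (A 1F 2F) (A 2F 0F) (A 2F 1F) (A 2F 2F)
            (B 0F 0F) (B 0F 1F) (B 0F 2F) (B 1F 0F) (B 1F 1F) (B 1F 2F) (B 2F 0F) (B 2F 1F) (B 2F 2F))
    where
    A B : Fin 3 → Fin 3 → ℚ
    A = mulMatrix x∈K
    B = mulMatrix y∈K

  norm-scale : ∀ {x z} (x∈K : x ∈ K) (z∈K : z ∈ K) q → z ≈ ι q * x →
               norm z∈K ≡ q ℚ.* q ℚ.* q ℚ.* norm x∈K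
  norm-scale x∈K z∈K q z≈qx = ≡.trans (det-cong (mulMatrix-scale x∈K z∈K q z≈qx))
    (det₃-scale q (A 0F 0F) (A 0F 1F) (A 0F 2F) (A 1F 0F) (A 1F 1F) (A 1F 2F)
                  (A 2F 0F) (A 2F 1F) (A 2F 2F))
    where
    A : Fin 3 → Fin 3 → ℚ
    A = mulMatrix x∈K

  identityMatrix : Fin 3 → Fin 3 → ℚ
  identityMatrix i j = + 1ᴹ i j ℚ./ 1

  norm-1 : norm 1∈K ≡ 1ℚ
  norm-1 = det-cong (mulMatrix-unique 1∈K identityMatrix eq)
    where
    eq : ∀ j → 1# * basis j ≈ span (λ i → identityMatrix i j)
    eq 0F = ≈-trans (*-congʳ (≈-sym 1#-homo))
      (solve 3 (λ x y z → con 1ℚ :* x := con 1ℚ :* x :+ (con 0ℚ :* y :+ con 0ℚ :* z)) ≈-refl _ _ _)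
    eq 1F = ≈-trans (*-congʳ (≈-sym 1#-homo))
      (solve 3 (λ x y z → con 1ℚ :* y := con 0ℚ :* x :+ (con 1ℚ :* y :+ con 0ℚ :* z)) ≈-refl _ _ _)
    eq 2F = ≈-trans (*-congʳ (≈-sym 1#-homo))
      (solve 3 (λ x y z → con 1ℚ :* z := con 0ℚ :* x :+ (con 0ℚ :* y :+ con 1ℚ :* z)) ≈-refl _ _ _)

  -- The norms of x and of its inverse multiply to the norm of 1, which is 1.
  norm≢0 : ∀ {x} (x∈K : x ∈ K) → ¬ (x ≈ 0#) → ¬ (norm x∈K ≡ 0ℚ)
  norm≢0 {x} x∈K x≉0 norm≡0 = contradiction
    (≡.trans (≡.sym norm-1)
    (≡.trans (norm-* x∈K (⁻¹-closed x∈K) 1∈K (≈-sym (⁻¹-inverseʳ x≉0)))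
    (≡.trans (≡.cong (ℚ._* norm (⁻¹-closed x∈K)) norm≡0)
             (ℚ.*-zeroˡ (norm (⁻¹-closed x∈K))))))
    λ ()

  ∣N∣ : ∀ {x} → x ∈ K → Carrier
  ∣N∣ x∈K = ι ℚ.∣ norm x∈K ∣

  ∣N∣-* : ∀ {x y z} (x∈K : x ∈ K) (y∈K : y ∈ K) (z∈K : z ∈ K) → z ≈ x * y →
          ∣N∣ z∈K ≈ ∣N∣ x∈K * ∣N∣ y∈K
  ∣N∣-* x∈K y∈K z∈K z≈xy = ≈-trans
    (⟦⟧-cong (≡.trans (≡.cong ℚ.∣_∣ (norm-* x∈K y∈K z∈K z≈xy)) (ℚ.∣p*q∣≡∣p∣*∣q∣ (norm x∈K) (norm y∈K))))
    (*-homo _ _)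

  ∣N∣-pos : ∀ {x} (x∈K : x ∈ K) → 0# < x → 0# < ∣N∣ x∈K
  ∣N∣-pos x∈K 0<x = ι∣q∣-pos (norm≢0 x∈K (0<x⇒x≉0 0<x))

  ∣N∣-cong : ∀ {x y} (x∈K : x ∈ K) (y∈K : y ∈ K) → x ≈ y → ∣N∣ x∈K ≈ ∣N∣ y∈K
  ∣N∣-cong x∈K y∈K x≈y = ⟦⟧-cong (≡.cong ℚ.∣_∣ (norm-cong x∈K y∈K x≈y))

  -- A lattice condition: d times the matrix of multiplication by x has integer entries. For fixed d
  -- it is stable under subtraction, so the steps of the algorithm preserve it.
  IntegralMultiple : ℕ → ∀ {x} → x ∈ K → Set ℓ₁
  IntegralMultiple d x∈K = ∀ i j → Integral (d · 1# * ι (mulMatrix x∈K i j))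

  integralMultiple-exists : ∀ {m} (x : Fin m → Carrier) (x∈K : ∀ i → x i ∈ K) →
                            ∃ λ d → (0 ℕ.< d) × (∀ i → IntegralMultiple d (x∈K i))
  integralMultiple-exists x x∈K =
    commonMultiple (λ i d → IntegralMultiple d (x∈K i))
      (λ a k {n} h i j → integral-scale k {n} (h i j)) λ a →
    commonMultiple (λ i d → ∀ j → Integral (d · 1# * _))
      (λ i k {n} h j → integral-scale k {n} (h j)) λ i →
    commonMultiple (λ j d → Integral (d · 1# * _)) (λ j k {n} → integral-scale k {n}) λ j →
    integral-multiple (mulMatrix (x∈K a) i j)

  integralMultiple-cong : ∀ {d x y} (x∈K : x ∈ K) (y∈K : y ∈ K) → x ≈ y →
                          IntegralMultiple d x∈K → IntegralMultiple d y∈K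
  integralMultiple-cong x∈K y∈K x≈y h i j =
    integral-resp (*-congˡ (⟦⟧-cong (mulMatrix-cong x∈K y∈K x≈y i j))) (h i j)

  integralMultiple-sub : ∀ {d x y z} (x∈K : x ∈ K) (y∈K : y ∈ K) (z∈K : z ∈ K) → z ≈ x - y →
    IntegralMultiple d x∈K → IntegralMultiple d y∈K → IntegralMultiple d z∈K
  integralMultiple-sub {d} x∈K y∈K z∈K z≈ hx hy i j = integral-resp (begin-equality
    d · 1# * ι (A i j) + - (d · 1# * ι (B i j))
      ≈⟨ solve 3 (λ d a b → d :* a :+ (:- (d :* b)) := d :* (a :- b)) ≈-refl _ _ _ ⟩
    d · 1# * (ι (A i j) - ι (B i j))
      ≈⟨ *-congˡ (ι-sub _ _) ⟨
    d · 1# * ι (A i j ℚ.- B i j)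
      ≡⟨ ≡.cong (λ q → d · 1# * ι q) (mulMatrix-sub x∈K y∈K z∈K z≈ i j) ⟨
    d · 1# * ι (mulMatrix z∈K i j) ∎)
    (integral-+ (hx i j) (integral-neg (hy i j)))
    where
    A B : Fin 3 → Fin 3 → ℚ
    A = mulMatrix x∈K
    B = mulMatrix y∈K

  private
    minor : ℚ → ℚ → ℚ → ℚ → ℚ
    minor e f h i = e ℚ.* i ℚ.- f ℚ.* h

    integral-minor : ∀ {D e f h i} → Integral (D * ι e) → Integral (D * ι f) → Integral (D * ι h) →
                     Integral (D * ι i) → Integral (D * D * ι (minor e f h i))
    integral-minor {D} {e} {f} {h} {i} he hf hh hi = integral-resp (begin-equality
      D * ι e * (D * ι i) + - (D * ι f * (D * ι h))
        ≈⟨ solve 5 (λ d e f h i → d :* e :* (d :* i) :+ (:- (d :* f :* (d :* h)))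
             := d :* d :* (e :* i :- f :* h)) ≈-refl D (ι e) (ι f) (ι h) (ι i) ⟩
      D * D * (ι e * ι i - ι f * ι h)
        ≈⟨ *-congˡ (≈-trans (ι-sub _ _) (+-cong (*-homo _ _) (-‿cong (*-homo _ _)))) ⟨
      D * D * ι (minor e f h i) ∎)
      (integral-+ (integral-* he hi) (integral-neg (integral-* hf hh)))

  -- Up to sign, d³ N(x) is the determinant of an integer matrix, namely d times the multiplication
  -- matrix. It is nonzero because x is, so its absolute value is a positive integer.
  integralMultiple⇒1≤ : ∀ {d x} (x∈K : x ∈ K) → 0 ℕ.< d → 0# < x → IntegralMultiple d x∈K →
                        1# ≤ d · 1# * (d · 1# * d · 1#) * ∣N∣ x∈K
  integralMultiple⇒1≤ {d} x∈K 0<d 0<x h = positive-integral⇒1≤ D³∣N∣-integral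
    (*-pos (*-pos 0<D (*-pos 0<D 0<D)) (∣N∣-pos x∈K 0<x))
    where
    D : Carrier
    D = d · 1#
    A : Fin 3 → Fin 3 → ℚ
    A = mulMatrix x∈K
    0<D : 0# < D
    0<D = ·-pos d {{ℕ.>-nonZero 0<d}} 0<1
    m₀ m₁ m₂ : ℚ
    m₀ = minor (A 1F 1F) (A 1F 2F) (A 2F 1F) (A 2F 2F)
    m₁ = minor (A 1F 0F) (A 1F 2F) (A 2F 0F) (A 2F 2F)
    m₂ = minor (A 1F 0F) (A 1F 1F) (A 2F 0F) (A 2F 1F)
    N : ℚ
    N = norm x∈K
    -- In the expansion along the first row each entry absorbs one factor `D` and each 2 × 2 minor
    -- absorbs two.
    D³N-integral : Integral (D * (D * D) * ι N)
    D³N-integral = integral-resp (begin-equality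
      D * ι (A 0F 0F) * (D * D * ι m₀) + - (D * ι (A 0F 1F) * (D * D * ι m₁))
        + D * ι (A 0F 2F) * (D * D * ι m₂)
        ≈⟨ solve 7 (λ d a b c x y z →
             d :* a :* (d :* d :* x) :+ (:- (d :* b :* (d :* d :* y))) :+ d :* c :* (d :* d :* z)
             := d :* (d :* d) :* (a :* x :- b :* y :+ c :* z)) ≈-refl
             D (ι (A 0F 0F)) (ι (A 0F 1F)) (ι (A 0F 2F)) (ι m₀) (ι m₁) (ι m₂) ⟩
      D * (D * D) * (ι (A 0F 0F) * ι m₀ - ι (A 0F 1F) * ι m₁ + ι (A 0F 2F) * ι m₂)
        ≈⟨ *-congˡ (≈-trans (+-homo _ _) (+-cong
             (≈-trans (ι-sub _ _) (+-cong (*-homo _ _) (-‿cong (*-homo _ _)))) (*-homo _ _))) ⟨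
      D * (D * D) * ι N ∎)
      (integral-+ (integral-+ (integral-* (h 0F 0F) m₀-integral)
                              (integral-neg (integral-* (h 0F 1F) m₁-integral)))
                  (integral-* (h 0F 2F) m₂-integral))
      where
      m₀-integral = integral-minor (h 1F 1F) (h 1F 2F) (h 2F 1F) (h 2F 2F)
      m₁-integral = integral-minor (h 1F 0F) (h 1F 2F) (h 2F 0F) (h 2F 2F)
      m₂-integral = integral-minor (h 1F 0F) (h 1F 1F) (h 2F 0F) (h 2F 1F)
    D³∣N∣-integral : Integral (D * (D * D) * ∣N∣ x∈K)
    D³∣N∣-integral with ι∣q∣≈±ιq N
    ... | inj₁ eq = integral-resp (*-congˡ (≈-sym eq)) D³N-integral
    ... | inj₂ eq = integral-resp (≈-trans
      (solve 2 (λ x y → :- (x :* y) := x :* (:- y)) ≈-refl (D * (D * D)) (ι N))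
      (*-congˡ (≈-sym eq))) (integral-neg D³N-integral)

-- Quadratic relations in a cubic field

module Quadratic {c ℓ₁ ℓ₂ k} (R : RealField c ℓ₁ ℓ₂) (F : CubicField R k) where
  open RealField R
  open RealFieldProperties R
  open CubicField F
  open OrderedField R
  open Norm R F
  open Solver using (solve; _:=_; _:+_; _:*_; _:-_; :-_; con)
  open ≤-Reasoning

  n·1∈K : ∀ n → n · 1# ∈ K
  n·1∈K zero    = K-resp-≈ (-‿inverseʳ 1#) (+-closed 1∈K (-‿closed 1∈K))
  n·1∈K (suc n) = +-closed 1∈K (n·1∈K n)

  ι[z/1]∈K : ∀ z → ι (z ℚ./ 1) ∈ K
  ι[z/1]∈K (+ n)    = K-resp-≈ (≈-sym (ι[n/1] n)) (n·1∈K n)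
  ι[z/1]∈K -[1+ n ] = K-resp-≈ (≈-sym (-‿homo _)) (-‿closed (ι[z/1]∈K (+ suc n)))

  ι∈K : ∀ q → ι q ∈ K
  ι∈K q@(mkℚ z d _) = K-resp-≈ (begin-equality
    ι (z ℚ./ 1) * D ⁻¹   ≈⟨ *-congʳ (ι-clearDenominator q) ⟨
    ι q * D * D ⁻¹       ≈⟨ *-assoc _ _ _ ⟩
    ι q * (D * D ⁻¹)     ≈⟨ *-congˡ (⁻¹-inverseʳ (0<x⇒x≉0 (·-pos (suc d) 0<1))) ⟩
    ι q * 1#             ≈⟨ *-identityʳ _ ⟩
    ι q                  ∎)
    (*-closed (ι[z/1]∈K z) (⁻¹-closed (n·1∈K (suc d))))
    where
    D : Carrier
    D = suc d · 1#

  -- Injectivity of `ι` comes from the order: a nonzero q has positive `ι ℚ.∣ q ∣`, which equals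
  -- `ι q` up to sign.
  ι≈0⇒≡0 : ∀ {q} → ι q ≈ 0# → q ≡ 0ℚ
  ι≈0⇒≡0 {q} ιq≈0 with q ℚ.≟ 0ℚ
  ... | yes q≡0 = q≡0
  ... | no  q≢0 with ι∣q∣≈±ιq q
  ... | inj₁ eq = contradiction (≈-trans eq ιq≈0) (0<x⇒x≉0 (ι∣q∣-pos q≢0))
  ... | inj₂ eq = contradiction (≈-trans eq (≈-trans (-‿cong ιq≈0)
    (≈-trans (≈-sym (+-identityˡ _)) (-‿inverseʳ 0#)))) (0<x⇒x≉0 (ι∣q∣-pos q≢0))

  p*q≢0 : ∀ {p q} → ¬ (p ≡ 0ℚ) → ¬ (q ≡ 0ℚ) → ¬ (p ℚ.* q ≡ 0ℚ)
  p*q≢0 {p} {q} p≢0 q≢0 pq≡0 = p≢0 (ι≈0⇒≡0 (x*y≈0⇒x≈0 (λ eq → q≢0 (ι≈0⇒≡0 eq))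
    (≈-trans (≈-sym (*-homo p q)) (≈-trans (⟦⟧-cong pq≡0) 0#-homo))))

  -- Multiplying η² = δt² by δ²n² makes both sides squares, (δnη)² = (et)², whence δnη = ± et. This
  -- is a linear relation between s and t whose s-coefficient δ · n · 2a is nonzero unless δ = 0,
  -- and in that case η = 0 is itself a relation with s-coefficient 2a.
  no-square-root : ∀ {s t} → (∀ p q → ι p * s + ι q * t ≈ 0# → (p ≡ 0ℚ) × (q ≡ 0ℚ)) →
    ∀ {2a n} b δ e → ¬ (2a ≡ 0ℚ) → ¬ (n ≡ 0ℚ) → e ℚ.* e ≡ δ ℚ.* δ ℚ.* δ ℚ.* (n ℚ.* n) →
    ¬ ((ι 2a * s + ι b * t) * (ι 2a * s + ι b * t) ≈ ι δ * (t * t))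
  no-square-root {s} {t} independent {2a} {n} b δ e 2a≢0 n≢0 e²≡δ³n² η²≈δt² = by-cases (δ ℚ.≟ 0ℚ)
    where
    η : Carrier
    η = ι 2a * s + ι b * t
    [δnη]²≈[et]² : (ι δ * ι n * η) * (ι δ * ι n * η) ≈ (ι e * t) * (ι e * t)
    [δnη]²≈[et]² = begin-equality
      (ι δ * ι n * η) * (ι δ * ι n * η)
        ≈⟨ solve 3 (λ d n h → d :* n :* h :* (d :* n :* h) := d :* d :* (n :* n) :* (h :* h))
             ≈-refl (ι δ) (ι n) η ⟩
      ι δ * ι δ * (ι n * ι n) * (η * η)
        ≈⟨ *-congˡ η²≈δt² ⟩
      ι δ * ι δ * (ι n * ι n) * (ι δ * (t * t))
        ≈⟨ solve 3 (λ d n t → d :* d :* (n :* n) :* (d :* (t :* t)) := d :* d :* d :* (n :* n) :* (t :* t))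
             ≈-refl (ι δ) (ι n) t ⟩
      ι δ * ι δ * ι δ * (ι n * ι n) * (t * t)
        ≈⟨ *-congʳ (≈-trans (*-homo _ _) (*-cong (≈-trans (*-homo _ _) (*-congʳ (*-homo _ _))) (*-homo _ _))) ⟨
      ι (δ ℚ.* δ ℚ.* δ ℚ.* (n ℚ.* n)) * (t * t)
        ≡⟨ ≡.cong (λ q → ι q * (t * t)) e²≡δ³n² ⟨
      ι (e ℚ.* e) * (t * t)
        ≈⟨ *-congʳ (*-homo _ _) ⟩
      ι e * ι e * (t * t)
        ≈⟨ solve 2 (λ e t → e :* e :* (t :* t) := e :* t :* (e :* t)) ≈-refl (ι e) t ⟩
      (ι e * t) * (ι e * t) ∎
    dependent : ∀ f → ι δ * ι n * η ≈ ι f * t → δ ℚ.* n ℚ.* 2a ≡ 0ℚ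
    dependent f h = proj₁ (independent (δ ℚ.* n ℚ.* 2a) (δ ℚ.* n ℚ.* b ℚ.- f) (begin-equality
      ι (δ ℚ.* n ℚ.* 2a) * s + ι (δ ℚ.* n ℚ.* b ℚ.- f) * t
        ≈⟨ +-cong (*-congʳ (δn 2a)) (*-congʳ (≈-trans (ι-sub _ _) (+-congʳ (δn b)))) ⟩
      ι δ * ι n * ι 2a * s + (ι δ * ι n * ι b - ι f) * t
        ≈⟨ solve 7 (λ d n a b f s t → d :* n :* a :* s :+ (d :* n :* b :- f) :* t
             := d :* n :* (a :* s :+ b :* t) :- f :* t) ≈-refl (ι δ) (ι n) (ι 2a) (ι b) (ι f) s t ⟩
      ι δ * ι n * η - ι f * t
        ≈⟨ +-congʳ h ⟩
      ι f * t - ι f * t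
        ≈⟨ -‿inverseʳ _ ⟩
      0# ∎))
      where
      δn : ∀ x → ι (δ ℚ.* n ℚ.* x) ≈ ι δ * ι n * ι x
      δn x = ≈-trans (*-homo _ _) (*-congʳ (*-homo _ _))
    δn2a≢0 : ¬ (δ ≡ 0ℚ) → ¬ (δ ℚ.* n ℚ.* 2a ≡ 0ℚ)
    δn2a≢0 δ≢0 = p*q≢0 {δ ℚ.* n} {2a} (p*q≢0 {δ} {n} δ≢0 n≢0) 2a≢0
    by-cases : Dec (δ ≡ 0ℚ) → ⊥
    by-cases (yes δ≡0) = 2a≢0 (proj₁ (independent 2a b (x*x≈0⇒x≈0 (begin-equality
      η * η           ≈⟨ η²≈δt² ⟩
      ι δ * (t * t)   ≈⟨ *-congʳ (≈-trans (⟦⟧-cong δ≡0) 0#-homo) ⟩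
      0# * (t * t)    ≈⟨ zeroˡ _ ⟩
      0#              ∎))))
    by-cases (no δ≢0) = [ (λ h → δn2a≢0 δ≢0 (dependent e h))
                        , (λ h → δn2a≢0 δ≢0 (dependent (ℚ.- e) (≈-trans h
      (≈-trans (solve 2 (λ e t → :- (e :* t) := (:- e) :* t) ≈-refl (ι e) t)
               (*-congʳ (≈-sym (-‿homo e))))))) ]′ (x²≈y²⇒x≈±y [δnη]²≈[et]²)

  -- Completing the square turns the relation into η² = δ t², and taking norms gives
  -- N(η)² = δ³ N(t)², so that δ N(t) η = ± N(η) t.
  no-quadratic-relation : ∀ {s t} → s ∈ K → t ∈ K →
    (∀ p q → ι p * s + ι q * t ≈ 0# → (p ≡ 0ℚ) × (q ≡ 0ℚ)) →
    ∀ {a} b c → ¬ (a ≡ 0ℚ) →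
    ¬ (ι a * (s * s) + ι b * (s * t) + ι c * (t * t) ≈ 0#)
  no-quadratic-relation {s} {t} s∈K t∈K independent {a} b c a≢0 eq =
    no-square-root independent b δ e 2a≢0 (norm≢0 t∈K t≉0) e²≡δ³n² η²≈δt²
    where
    2a δ : ℚ
    2a = 2ℚ ℚ.* a
    δ  = b ℚ.* b ℚ.- 2ℚ ℚ.* 2ℚ ℚ.* (a ℚ.* c)
    2a≢0 : ¬ (2a ≡ 0ℚ)
    2a≢0 = p*q≢0 {2ℚ} {a} (λ ()) a≢0
    t≉0 : ¬ (t ≈ 0#)
    t≉0 t≈0 = contradiction (proj₂ (independent 0ℚ 1ℚ (begin-equality
      ι 0ℚ * s + ι 1ℚ * t  ≈⟨ solve 2 (λ s t → con 0ℚ :* s :+ con 1ℚ :* t := t) ≈-refl s t ⟩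
      t                    ≈⟨ t≈0 ⟩
      0#                   ∎))) λ ()
    η : Carrier
    η = ι 2a * s + ι b * t
    η∈K : η ∈ K
    η∈K = +-closed (*-closed (ι∈K 2a) s∈K) (*-closed (ι∈K b) t∈K)
    ιδ : ι δ ≈ ι b * ι b - ι 2ℚ * ι 2ℚ * (ι a * ι c)
    ιδ = ≈-trans (ι-sub _ _) (+-cong (*-homo _ _)
           (-‿cong (≈-trans (*-homo _ _) (*-cong (*-homo _ _) (*-homo _ _)))))
    η²≈δt² : η * η ≈ ι δ * (t * t)
    η²≈δt² = begin-equality
      η * η
        ≈⟨ *-cong ιη ιη ⟩
      (ι 2ℚ * ι a * s + ι b * t) * (ι 2ℚ * ι a * s + ι b * t)
        ≈⟨ solve 5 (λ a b c s t →
             (con 2ℚ :* a :* s :+ b :* t) :* (con 2ℚ :* a :* s :+ b :* t)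
             := (b :* b :- con 2ℚ :* con 2ℚ :* (a :* c)) :* (t :* t)
             :+ con 2ℚ :* con 2ℚ :* a :* (a :* (s :* s) :+ b :* (s :* t) :+ c :* (t :* t)))
             ≈-refl (ι a) (ι b) (ι c) s t ⟩
      (ι b * ι b - ι 2ℚ * ι 2ℚ * (ι a * ι c)) * (t * t)
        + ι 2ℚ * ι 2ℚ * ι a * (ι a * (s * s) + ι b * (s * t) + ι c * (t * t))
        ≈⟨ +-cong (*-congʳ (≈-sym ιδ)) (≈-trans (*-congˡ eq) (zeroʳ _)) ⟩
      ι δ * (t * t) + 0#
        ≈⟨ +-identityʳ _ ⟩
      ι δ * (t * t) ∎
      where
      ιη : η ≈ ι 2ℚ * ι a * s + ι b * t
      ιη = +-congʳ (*-congʳ (*-homo 2ℚ a))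
    e n : ℚ
    e = norm η∈K
    n = norm t∈K
    e²≡δ³n² : e ℚ.* e ≡ δ ℚ.* δ ℚ.* δ ℚ.* (n ℚ.* n)
    e²≡δ³n² = ≡.trans (≡.sym (norm-* η∈K η∈K (*-closed η∈K η∈K) ≈-refl))
      (≡.trans (norm-scale (*-closed t∈K t∈K) (*-closed η∈K η∈K) δ η²≈δt²)
               (≡.cong (δ ℚ.* δ ℚ.* δ ℚ.*_) (norm-* t∈K t∈K (*-closed t∈K t∈K) ≈-refl)))

-- Products of elementary matrices

other₁ other₂ : Fin 3 → Fin 3
other₁ 0F = 1F
other₁ 1F = 0F
other₁ 2F = 0F
other₂ 0F = 2F
other₂ 1F = 2F
other₂ 2F = 1F

other₁≢ : ∀ k → other₁ k ≢ k
other₁≢ = from-yes (all? λ k → ¬? (other₁ k Fin.≟ k))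

other₂≢ : ∀ k → other₂ k ≢ k
other₂≢ = from-yes (all? λ k → ¬? (other₂ k Fin.≟ k))

other₁≢other₂ : ∀ k → other₁ k ≢ other₂ k
other₁≢other₂ = from-yes (all? λ k → ¬? (other₁ k Fin.≟ other₂ k))

≢⇒other : ∀ k i → i ≢ k → (i ≡ other₁ k) ⊎ (i ≡ other₂ k)
≢⇒other = from-yes (all? λ k → all? λ i →
  ¬? (i Fin.≟ k) →-dec ((i Fin.≟ other₁ k) ⊎-dec (i Fin.≟ other₂ k)))

fst≢snd : ∀ e → fst e ≢ snd e
fst≢snd ⟨12⟩ ()
fst≢snd ⟨21⟩ ()
fst≢snd ⟨01⟩ ()
fst≢snd ⟨10⟩ ()
fst≢snd ⟨02⟩ ()
fst≢snd ⟨20⟩ ()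

-- A step that never subtracts coordinate k either acts inside the pair of the other two indices or
-- changes coordinate k alone.
edges-avoiding-target : ∀ k i j → i ≢ j → j ≢ k →
  ((i ≡ other₁ k) × (j ≡ other₂ k)) ⊎ ((i ≡ other₂ k) × (j ≡ other₁ k)) ⊎ (i ≡ k)
edges-avoiding-target = from-yes (all? λ k → all? λ i → all? λ j →
  ¬? (i Fin.≟ j) →-dec (¬? (j Fin.≟ k) →-dec
    (((i Fin.≟ other₁ k) ×-dec (j Fin.≟ other₂ k)) ⊎-dec
    (((i Fin.≟ other₂ k) ×-dec (j Fin.≟ other₁ k)) ⊎-dec (i Fin.≟ k)))))

*ᴹ-pos : ∀ (A B : Matrix) i k j → 0 ℕ.< A i k → 0 ℕ.< B k j → 0 ℕ.< (A *ᴹ B) i j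
*ᴹ-pos A B i k j 0<a 0<b = ℕ.<-≤-trans (ℕ.*-mono-< 0<a 0<b) (term≤sum k)
  where
  f : Fin 3 → ℕ
  f k = A i k ℕ.* B k j
  term≤sum : ∀ k → f k ℕ.≤ f 0F ℕ.+ (f 1F ℕ.+ (f 2F ℕ.+ 0))
  term≤sum 0F = ℕ.m≤m+n _ _
  term≤sum 1F = ℕ.m≤n⇒m≤o+n (f 0F) (ℕ.m≤m+n _ _)
  term≤sum 2F = ℕ.m≤n⇒m≤o+n (f 0F) (ℕ.m≤n⇒m≤o+n (f 1F) (ℕ.m≤m+n _ _))

1ᴹ-diagonal : ∀ i → 0 ℕ.< 1ᴹ i i
1ᴹ-diagonal 0F = ℕ.z<s
1ᴹ-diagonal 1F = ℕ.z<s
1ᴹ-diagonal 2F = ℕ.z<s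

M-diagonal : ∀ e i → 0 ℕ.< M e i i
M-diagonal e 0F = ℕ.z<s
M-diagonal e 1F = ℕ.z<s
M-diagonal e 2F = ℕ.z<s

M-edge : ∀ e → 0 ℕ.< M e (fst e) (snd e)
M-edge ⟨12⟩ = ℕ.z<s
M-edge ⟨21⟩ = ℕ.z<s
M-edge ⟨01⟩ = ℕ.z<s
M-edge ⟨10⟩ = ℕ.z<s
M-edge ⟨02⟩ = ℕ.z<s
M-edge ⟨20⟩ = ℕ.z<s

productM-diagonal : ∀ e l i → 0 ℕ.< productM e l i i
productM-diagonal e zero    i = 1ᴹ-diagonal i
productM-diagonal e (suc l) i =
  *ᴹ-pos (M (e 0)) (productM (λ n → e (suc n)) l) i i i (M-diagonal (e 0) i) (productM-diagonal _ l i)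

-- Diagonal entries of all factors are positive: a path can wait at `fst (e n)`, move at the factor
-- with index n, and wait at `snd (e n)` afterwards. Entries are natural numbers, so nothing cancels
-- this contribution.
productM-edge : ∀ e l n → n ℕ.< l → 0 ℕ.< productM e l (fst (e n)) (snd (e n))
productM-edge e (suc l) n n<1+l with n | n<1+l
... | zero  | _         = *ᴹ-pos (M (e 0)) (productM (λ n → e (suc n)) l) _ _ _
  (M-edge (e 0)) (productM-diagonal _ l (snd (e 0)))
... | suc m | ℕ.s≤s m<l = *ᴹ-pos (M (e 0)) (productM (λ n → e (suc n)) l) _ _ _
  (M-diagonal (e 0) (fst (e (suc m)))) (productM-edge (λ n → e (suc n)) l m m<l)

productM-cong : ∀ {e e′} → (∀ n → e n ≡ e′ n) → ∀ l i j → productM e l i j ≡ productM e′ l i j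
productM-cong eq zero    i j = refl
productM-cong {e} {e′} eq (suc l) i j rewrite eq 0
  | productM-cong (λ n → eq (suc n)) l 0F j
  | productM-cong (λ n → eq (suc n)) l 1F j
  | productM-cong (λ n → eq (suc n)) l 2F j = refl

-- Periodic sequences of steps

periodic-+* : ∀ {a} {A : Set a} {f : ℕ → A} {l} → (∀ n → f (n ℕ.+ l) ≡ f n) →
              ∀ j n → f (n ℕ.+ j ℕ.* l) ≡ f n
periodic-+* {f = f} {l} periodic zero    n = ≡.cong f (ℕ.+-identityʳ n)
periodic-+* {f = f} {l} periodic (suc j) n = ≡.trans
  (≡.cong f (≡.trans (≡.cong (n ℕ.+_) (ℕ.+-comm l (j ℕ.* l))) (≡.sym (ℕ.+-assoc n (j ℕ.* l) l))))
  (≡.trans (periodic (n ℕ.+ j ℕ.* l)) (periodic-+* {f = f} periodic j n))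

periodic-% : ∀ {a} {A : Set a} {f : ℕ → A} {l} .{{_ : NonZero l}} → (∀ n → f (n ℕ.+ l) ≡ f n) →
             ∀ n → f (n ℕ.% l) ≡ f n
periodic-% {f = f} {l} periodic n = ≡.trans (≡.sym (periodic-+* {f = f} periodic (n ℕ./ l) (n ℕ.% l)))
                                            (≡.cong f (≡.sym (ℕ.m≡m%n+[m/n]*n n l)))

module _ {e : ℕ → Ind} {l} (0<l : 0 ℕ.< l) (periodic : ∀ n → e (n ℕ.+ l) ≡ e n) where

  edge⇒productM-pos : ∀ n → 0 ℕ.< productM e l (fst (e n)) (snd (e n))
  edge⇒productM-pos n = ≡.subst (λ e′ → 0 ℕ.< productM e l (fst e′) (snd e′))
    (periodic-% {f = e} periodic n)
    (productM-edge e l (n ℕ.% l) (ℕ.m%n<n n l))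
    where
    instance
      l≢0 : NonZero l
      l≢0 = ℕ.>-nonZero 0<l

  -- A step with first entry k would leave a positive off-diagonal entry in row k of the product
  -- over a period.
  zero-row⇒never-source : ∀ k → productM e l k (other₁ k) ≡ 0 → productM e l k (other₂ k) ≡ 0 →
                          ∀ n → fst (e n) ≢ k
  zero-row⇒never-source k eq₁ eq₂ n refl
    with ≢⇒other (fst (e n)) (snd (e n)) (λ eq → fst≢snd (e n) (≡.sym eq))
  ... | inj₁ eq = ℕ.<-irrefl (≡.sym eq₁)
    (≡.subst (λ j → 0 ℕ.< productM e l (fst (e n)) j) eq (edge⇒productM-pos n))
  ... | inj₂ eq = ℕ.<-irrefl (≡.sym eq₂)
    (≡.subst (λ j → 0 ℕ.< productM e l (fst (e n)) j) eq (edge⇒productM-pos n))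

  zero-column⇒never-target : ∀ k → productM e l (other₁ k) k ≡ 0 → productM e l (other₂ k) k ≡ 0 →
                             ∀ n → snd (e n) ≢ k
  zero-column⇒never-target k eq₁ eq₂ n refl with ≢⇒other (snd (e n)) (fst (e n)) (fst≢snd (e n))
  ... | inj₁ eq = ℕ.<-irrefl (≡.sym eq₁)
    (≡.subst (λ i → 0 ℕ.< productM e l i (snd (e n))) eq (edge⇒productM-pos n))
  ... | inj₂ eq = ℕ.<-irrefl (≡.sym eq₂)
    (≡.subst (λ i → 0 ℕ.< productM e l i (snd (e n))) eq (edge⇒productM-pos n))

-- A criterion for a positive square

module _ {A : Matrix} (diagonal : ∀ i → 0 ℕ.< A i i)
         (row : ∀ k → (0 ℕ.< A k (other₁ k)) ⊎ (0 ℕ.< A k (other₂ k))) where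

  -- Row `other₁ k` has a positive off-diagonal entry; once column k is excluded, only column
  -- `other₂ k` is left for it.
  other₁→other₂ : ∀ k → A (other₁ k) k ≡ 0 → 0 ℕ.< A (other₁ k) (other₂ k)
  other₁→other₂ 0F eq with row 1F
  ... | inj₁ 0<a = contradiction (≡.sym eq) (ℕ.<⇒≢ 0<a)
  ... | inj₂ 0<a = 0<a
  other₁→other₂ 1F eq with row 0F
  ... | inj₁ 0<a = contradiction (≡.sym eq) (ℕ.<⇒≢ 0<a)
  ... | inj₂ 0<a = 0<a
  other₁→other₂ 2F eq with row 0F
  ... | inj₁ 0<a = 0<a
  ... | inj₂ 0<a = contradiction (≡.sym eq) (ℕ.<⇒≢ 0<a)

  other₂→other₁ : ∀ k → A (other₂ k) k ≡ 0 → 0 ℕ.< A (other₂ k) (other₁ k)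
  other₂→other₁ 0F eq with row 2F
  ... | inj₁ 0<a = contradiction (≡.sym eq) (ℕ.<⇒≢ 0<a)
  ... | inj₂ 0<a = 0<a
  other₂→other₁ 1F eq with row 2F
  ... | inj₁ 0<a = 0<a
  ... | inj₂ 0<a = contradiction (≡.sym eq) (ℕ.<⇒≢ 0<a)
  other₂→other₁ 2F eq with row 1F
  ... | inj₁ 0<a = 0<a
  ... | inj₂ 0<a = contradiction (≡.sym eq) (ℕ.<⇒≢ 0<a)

  module _ (column : ∀ k → (0 ℕ.< A (other₁ k) k) ⊎ (0 ℕ.< A (other₂ k) k)) where

    -- For i ≠ j let m be the third index. The row condition at i gives an edge from i to j or to m,
    -- the column condition at j gives an edge into j from i or from m. So there is either a direct
    -- edge, completed by a loop at i, or the path through m. `swap` puts the direct edge first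
    -- where the order of indices does not.
    square-pos : ∀ i j → 0 ℕ.< (A ^ᴹ 2) i j
    square-pos = λ where
        0F 0F → two-steps 0F 0F 0F (diagonal 0F) (diagonal 0F)
        1F 1F → two-steps 1F 1F 1F (diagonal 1F) (diagonal 1F)
        2F 2F → two-steps 2F 2F 2F (diagonal 2F) (diagonal 2F)
        0F 1F → path 0F 2F 1F (row 0F) (column 1F)
        0F 2F → path 0F 1F 2F (swap (row 0F)) (column 2F)
        1F 0F → path 1F 2F 0F (row 1F) (column 0F)
        1F 2F → path 1F 0F 2F (swap (row 1F)) (swap (column 2F))
        2F 0F → path 2F 1F 0F (row 2F) (swap (column 0F))
        2F 1F → path 2F 0F 1F (swap (row 2F)) (swap (column 1F))
      where
      two-steps : ∀ i m j → 0 ℕ.< A i m → 0 ℕ.< A m j → 0 ℕ.< (A ^ᴹ 2) i j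
      two-steps i m j p q = *ᴹ-pos A (A *ᴹ 1ᴹ) i m j p (*ᴹ-pos A 1ᴹ m j j q (1ᴹ-diagonal j))
      path : ∀ i m j → (0 ℕ.< A i j) ⊎ (0 ℕ.< A i m) → (0 ℕ.< A i j) ⊎ (0 ℕ.< A m j) →
             0 ℕ.< (A ^ᴹ 2) i j
      path i m j (inj₁ p) _        = two-steps i i j (diagonal i) p
      path i m j _        (inj₁ p) = two-steps i i j (diagonal i) p
      path i m j (inj₂ p) (inj₂ q) = two-steps i m j p q

-- Subtractive sequences

module Dynamics {c ℓ₁ ℓ₂} (R : RealField c ℓ₁ ℓ₂) where
  open RealField R
  open RealFieldProperties R
  open OrderedField R
  open Solver using (solve; _:=_; _:+_; _:*_; _:-_; :-_; con)
  open Mult semiring using (×-homo-+; ×1-homo-*)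
  open ≤-Reasoning

  -- Natural numbers enter through ℚ, so that matrix entries can serve as rational coefficients of
  -- the final quadratic relation and the entries 0 and 1 are constants for the solver.
  ⌞_⌟ : ℕ → Carrier
  ⌞ n ⌟ = ι (+ n ℚ./ 1)

  ⌞⌟-+ : ∀ m n → ⌞ m ℕ.+ n ⌟ ≈ ⌞ m ⌟ + ⌞ n ⌟
  ⌞⌟-+ m n = ≈-trans (ι[n/1] (m ℕ.+ n)) (≈-trans (×-homo-+ 1# m n)
    (≈-sym (+-cong (ι[n/1] m) (ι[n/1] n))))

  ⌞⌟-* : ∀ m n → ⌞ m ℕ.* n ⌟ ≈ ⌞ m ⌟ * ⌞ n ⌟
  ⌞⌟-* m n = ≈-trans (ι[n/1] (m ℕ.* n)) (≈-trans (×1-homo-* m n)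
    (≈-sym (*-cong (ι[n/1] m) (ι[n/1] n))))

  x≤⌞n⌟*x : ∀ {n x} → 0 ℕ.< n → 0# < x → x ≤ ⌞ n ⌟ * x
  x≤⌞n⌟*x {suc n} {x} _ 0<x = begin
    x                ≈⟨ *-identityˡ x ⟨
    1# * x           ≤⟨ *-monoˡ-≤ 0<x (x≤x+y (0≤n·1 n)) ⟩
    suc n · 1# * x   ≈⟨ *-congʳ (ι[n/1] (suc n)) ⟨
    ⌞ suc n ⌟ * x    ∎

  infixl 7 _*ⱽ_
  _*ⱽ_ : Matrix → (Fin 3 → Carrier) → Fin 3 → Carrier
  (A *ⱽ y) i = ⌞ A i 0F ⌟ * y 0F + (⌞ A i 1F ⌟ * y 1F + ⌞ A i 2F ⌟ * y 2F)

  *ⱽ-cong : ∀ A {y z} → (∀ i → y i ≈ z i) → ∀ i → (A *ⱽ y) i ≈ (A *ⱽ z) i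
  *ⱽ-cong A y≈z i = +-cong (*-congˡ (y≈z 0F)) (+-cong (*-congˡ (y≈z 1F)) (*-congˡ (y≈z 2F)))

  *ⱽ-congˡ : ∀ A B y i → (∀ j → A i j ≡ B i j) → (A *ⱽ y) i ≈ (B *ⱽ y) i
  *ⱽ-congˡ A B y i eq = +-cong (entry 0F) (+-cong (entry 1F) (entry 2F))
    where
    entry : ∀ j → ⌞ A i j ⌟ * y j ≈ ⌞ B i j ⌟ * y j
    entry j = *-congʳ (⟦⟧-cong (≡.cong (λ n → + n ℚ./ 1) (eq j)))

  *ⱽ-assoc : ∀ A B y i → (A *ᴹ B *ⱽ y) i ≈ (A *ⱽ (B *ⱽ y)) i
  *ⱽ-assoc A B y i = ≈-trans
    (+-cong (*-congʳ (entry 0F)) (+-cong (*-congʳ (entry 1F)) (*-congʳ (entry 2F))))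
    (solve 15 (λ a₀ a₁ a₂ b₀₀ b₀₁ b₀₂ b₁₀ b₁₁ b₁₂ b₂₀ b₂₁ b₂₂ y₀ y₁ y₂ →
       (a₀ :* b₀₀ :+ (a₁ :* b₁₀ :+ a₂ :* b₂₀)) :* y₀
       :+ ((a₀ :* b₀₁ :+ (a₁ :* b₁₁ :+ a₂ :* b₂₁)) :* y₁
       :+ (a₀ :* b₀₂ :+ (a₁ :* b₁₂ :+ a₂ :* b₂₂)) :* y₂)
       := a₀ :* (b₀₀ :* y₀ :+ (b₀₁ :* y₁ :+ b₀₂ :* y₂))
       :+ (a₁ :* (b₁₀ :* y₀ :+ (b₁₁ :* y₁ :+ b₁₂ :* y₂))
       :+ a₂ :* (b₂₀ :* y₀ :+ (b₂₁ :* y₁ :+ b₂₂ :* y₂)))) ≈-refl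
       ⌞ A i 0F ⌟ ⌞ A i 1F ⌟ ⌞ A i 2F ⌟
       ⌞ B 0F 0F ⌟ ⌞ B 0F 1F ⌟ ⌞ B 0F 2F ⌟ ⌞ B 1F 0F ⌟ ⌞ B 1F 1F ⌟ ⌞ B 1F 2F ⌟
       ⌞ B 2F 0F ⌟ ⌞ B 2F 1F ⌟ ⌞ B 2F 2F ⌟ (y 0F) (y 1F) (y 2F))
    where
    entry : ∀ j → ⌞ (A *ᴹ B) i j ⌟
                ≈ ⌞ A i 0F ⌟ * ⌞ B 0F j ⌟ + (⌞ A i 1F ⌟ * ⌞ B 1F j ⌟ + ⌞ A i 2F ⌟ * ⌞ B 2F j ⌟)
    entry j = begin-equality
      ⌞ a 0F ℕ.+ (a 1F ℕ.+ (a 2F ℕ.+ 0)) ⌟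
        ≡⟨ ≡.cong (λ n → ⌞ a 0F ℕ.+ (a 1F ℕ.+ n) ⌟) (ℕ.+-identityʳ (a 2F)) ⟩
      ⌞ a 0F ℕ.+ (a 1F ℕ.+ a 2F) ⌟
        ≈⟨ ≈-trans (⌞⌟-+ (a 0F) _) (+-congˡ (⌞⌟-+ (a 1F) (a 2F))) ⟩
      ⌞ a 0F ⌟ + (⌞ a 1F ⌟ + ⌞ a 2F ⌟)
        ≈⟨ +-cong (⌞⌟-* (A i 0F) (B 0F j)) (+-cong (⌞⌟-* (A i 1F) (B 1F j)) (⌞⌟-* (A i 2F) (B 2F j))) ⟩
      _ ∎
      where
      a : Fin 3 → ℕ
      a k = A i k ℕ.* B k j

  1ᴹ-*ⱽ : ∀ y i → (1ᴹ *ⱽ y) i ≈ y i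
  1ᴹ-*ⱽ y 0F = solve 3 (λ x y z → con 1ℚ :* x :+ (con 0ℚ :* y :+ con 0ℚ :* z) := x) ≈-refl _ _ _
  1ᴹ-*ⱽ y 1F = solve 3 (λ x y z → con 0ℚ :* x :+ (con 1ℚ :* y :+ con 0ℚ :* z) := y) ≈-refl _ _ _
  1ᴹ-*ⱽ y 2F = solve 3 (λ x y z → con 0ℚ :* x :+ (con 0ℚ :* y :+ con 1ℚ :* z) := z) ≈-refl _ _ _

  M-*ⱽ-fst : ∀ e y → (M e *ⱽ y) (fst e) ≈ y (fst e) + y (snd e)
  M-*ⱽ-fst ⟨12⟩ y =
    solve 3 (λ x y z → con 0ℚ :* x :+ (con 1ℚ :* y :+ con 1ℚ :* z) := y :+ z) ≈-refl _ _ _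
  M-*ⱽ-fst ⟨21⟩ y =
    solve 3 (λ x y z → con 0ℚ :* x :+ (con 1ℚ :* y :+ con 1ℚ :* z) := z :+ y) ≈-refl _ _ _
  M-*ⱽ-fst ⟨01⟩ y =
    solve 3 (λ x y z → con 1ℚ :* x :+ (con 1ℚ :* y :+ con 0ℚ :* z) := x :+ y) ≈-refl _ _ _
  M-*ⱽ-fst ⟨10⟩ y =
    solve 3 (λ x y z → con 1ℚ :* x :+ (con 1ℚ :* y :+ con 0ℚ :* z) := y :+ x) ≈-refl _ _ _
  M-*ⱽ-fst ⟨02⟩ y =
    solve 3 (λ x y z → con 1ℚ :* x :+ (con 0ℚ :* y :+ con 1ℚ :* z) := x :+ z) ≈-refl _ _ _
  M-*ⱽ-fst ⟨20⟩ y =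
    solve 3 (λ x y z → con 1ℚ :* x :+ (con 0ℚ :* y :+ con 1ℚ :* z) := z :+ x) ≈-refl _ _ _

  M-row : ∀ e i → i ≢ fst e → ∀ j → M e i j ≡ 1ᴹ i j
  M-row e i i≢fst j with i Fin.≟ j | i Fin.≟ fst e
  ... | yes _ | _       = refl
  ... | no _  | yes i≡f = contradiction i≡f i≢fst
  ... | no _  | no _    = refl

  M-*ⱽ-other : ∀ e y i → i ≢ fst e → (M e *ⱽ y) i ≈ y i
  M-*ⱽ-other e y i i≢fst = ≈-trans (*ⱽ-congˡ (M e) 1ᴹ y i (M-row e i i≢fst)) (1ᴹ-*ⱽ y i)

  sum-around : ∀ (y : Fin 3 → Carrier) k → y 0F + (y 1F + y 2F) ≈ y k + (y (other₁ k) + y (other₂ k))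
  sum-around y 0F = ≈-refl
  sum-around y 1F = solve 3 (λ x y z → x :+ (y :+ z) := y :+ (x :+ z)) ≈-refl _ _ _
  sum-around y 2F = solve 3 (λ x y z → x :+ (y :+ z) := z :+ (x :+ y)) ≈-refl _ _ _

  module Subtractive
    (e : ℕ → Ind) (Y : ℕ → Fin 3 → Carrier)
    (Y-pos   : ∀ n i → 0# < Y n i)
    (Y-fst   : ∀ n → Y (suc n) (fst (e n)) ≈ Y n (fst (e n)) - Y n (snd (e n)))
    (Y-other : ∀ n i → i ≢ fst (e n) → Y (suc n) i ≈ Y n i)
    where

    Y-snd : ∀ n → Y (suc n) (snd (e n)) ≈ Y n (snd (e n))
    Y-snd n = Y-other n _ (λ eq → fst≢snd (e n) (≡.sym eq))

    never-source⇒constant : ∀ k → (∀ n → fst (e n) ≢ k) → ∀ n → Y n k ≈ Y 0 k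
    never-source⇒constant k never zero    = ≈-refl
    never-source⇒constant k never (suc n) =
      ≈-trans (Y-other n k (λ eq → never n (≡.sym eq))) (never-source⇒constant k never n)

    -- The sum of the three coordinates drops at step n by exactly the subtracted coordinate
    -- `Y n (snd (e n))`, so a uniform lower bound on these would be an infinite descent.
    ¬-bounded-below : ∀ {δ} → 0# < δ → ¬ (∀ n → δ ≤ Y n (snd (e n)))
    ¬-bounded-below {δ} 0<δ δ≤ = ¬-infinite-descent total 0<δ
      (λ n → +-pos (Y-pos n 0F) (+-pos (Y-pos n 1F) (Y-pos n 2F))) λ n → begin
        total (suc n) + δ             ≤⟨ +-monoʳ-≤ _ (δ≤ n) ⟩
        total (suc n) + Y n (snd (e n))  ≈⟨ total-step n ⟩
        total n                       ∎
      where
      total : ℕ → Carrier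
      total n = Y n 0F + (Y n 1F + Y n 2F)
      total-step : ∀ n → total (suc n) + Y n (snd (e n)) ≈ total n
      total-step n = begin-equality
        total (suc n) + Y n (snd (e n))
          ≈⟨ +-congʳ (sum-around (Y (suc n)) f) ⟩
        Y (suc n) f + (Y (suc n) (other₁ f) + Y (suc n) (other₂ f)) + Y n (snd (e n))
          ≈⟨ +-congʳ (+-cong (Y-fst n) (+-cong (Y-other n _ (other₁≢ f)) (Y-other n _ (other₂≢ f)))) ⟩
        Y n f - Y n (snd (e n)) + (Y n (other₁ f) + Y n (other₂ f)) + Y n (snd (e n))
          ≈⟨ solve 4 (λ f s x y → f :- s :+ (x :+ y) :+ s := f :+ (x :+ y)) ≈-refl _ _ _ _ ⟩
        Y n f + (Y n (other₁ f) + Y n (other₂ f))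
          ≈⟨ sum-around (Y n) f ⟨
        total n ∎
        where
        f : Fin 3
        f = fst (e n)

    -- Inverts the subtraction: the coordinate at `snd (e n)` is unchanged by the step, so adding it
    -- back is multiplication by `M (e n)`.
    Y-step : ∀ n i → Y n i ≈ (M (e n) *ⱽ Y (suc n)) i
    Y-step n i = by-cases (i Fin.≟ fst (e n))
      where
      by-cases : Dec (i ≡ fst (e n)) → Y n i ≈ (M (e n) *ⱽ Y (suc n)) i
      by-cases (yes refl) = ≈-sym (begin-equality
        (M (e n) *ⱽ Y (suc n)) i                    ≈⟨ M-*ⱽ-fst (e n) (Y (suc n)) ⟩
        Y (suc n) i + Y (suc n) (snd (e n))         ≈⟨ +-cong (Y-fst n) (Y-snd n) ⟩
        Y n i - Y n (snd (e n)) + Y n (snd (e n))   ≈⟨ solve 2 (λ x y → x :- y :+ y := x) ≈-refl _ _ ⟩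
        Y n i                                       ∎)
      by-cases (no i≢fst) = ≈-sym (≈-trans (M-*ⱽ-other (e n) (Y (suc n)) i i≢fst) (Y-other n i i≢fst))

    Y-expand : ∀ l n i → Y n i ≈ (productM (λ m → e (m ℕ.+ n)) l *ⱽ Y (l ℕ.+ n)) i
    Y-expand zero    n i = ≈-sym (1ᴹ-*ⱽ (Y n) i)
    Y-expand (suc l) n i = begin-equality
      Y n i
        ≈⟨ Y-step n i ⟩
      (M (e n) *ⱽ Y (suc n)) i
        ≈⟨ *ⱽ-cong (M (e n)) (Y-expand l (suc n)) i ⟩
      (M (e n) *ⱽ (productM (λ m → e (m ℕ.+ suc n)) l *ⱽ Y (l ℕ.+ suc n))) i
        ≈⟨ *ⱽ-cong (M (e n)) (λ j → *ⱽ-congˡ (productM (λ m → e (m ℕ.+ suc n)) l) P (Y (l ℕ.+ suc n)) j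
             (productM-cong (λ m → ≡.cong e (ℕ.+-suc m n)) l j)) i ⟩
      (M (e n) *ⱽ (P *ⱽ Y (l ℕ.+ suc n))) i
        ≡⟨ ≡.cong (λ m → (M (e n) *ⱽ (P *ⱽ Y m)) i) (ℕ.+-suc l n) ⟩
      (M (e n) *ⱽ (P *ⱽ Y (suc l ℕ.+ n))) i
        ≈⟨ *ⱽ-assoc (M (e n)) P (Y (suc l ℕ.+ n)) i ⟨
      (M (e n) *ᴹ P *ⱽ Y (suc l ℕ.+ n)) i ∎
      where
      P : Matrix
      P = productM (λ m → e (suc m ℕ.+ n)) l

    -- Periodic steps and the Wronskian

    module Periodic (l : ℕ) (periodic : ∀ n → e (n ℕ.+ l) ≡ e n) where
      A : Matrix
      A = productM e l

      module _ (k : Fin 3) (never : ∀ n → snd (e n) ≢ k)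
               (A₁ₖ≡0 : A (other₁ k) k ≡ 0) (A₂ₖ≡0 : A (other₂ k) k ≡ 0)
               (0<A₁₂ : 0 ℕ.< A (other₁ k) (other₂ k)) (0<A₂₁ : 0 ℕ.< A (other₂ k) (other₁ k)) where

        private
          a b : Fin 3
          a = other₁ k
          b = other₂ k

          s t : ℕ → Carrier
          s n = Y n a
          t n = Y n b

        -- By periodicity every period contributes the same matrix `A`. In a row whose entry in
        -- column k vanishes, only the 2 × 2 block on the other two indices acts.
        expand : ∀ {i} → A i k ≡ 0 → ∀ j →
                 Y (j ℕ.* l) i ≈ ⌞ A i a ⌟ * s (suc j ℕ.* l) + ⌞ A i b ⌟ * t (suc j ℕ.* l)
        expand {i} Aᵢₖ≡0 j = begin-equality
          Y (j ℕ.* l) i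
            ≈⟨ Y-expand l (j ℕ.* l) i ⟩
          (productM (λ m → e (m ℕ.+ j ℕ.* l)) l *ⱽ Y (suc j ℕ.* l)) i
            ≈⟨ *ⱽ-congˡ (productM (λ m → e (m ℕ.+ j ℕ.* l)) l) A (Y (suc j ℕ.* l)) i
                 (productM-cong (periodic-+* {f = e} periodic j) l i) ⟩
          (A *ⱽ Y (suc j ℕ.* l)) i
            ≈⟨ sum-around (λ m → ⌞ A i m ⌟ * Y (suc j ℕ.* l) m) k ⟩
          ⌞ A i k ⌟ * Y (suc j ℕ.* l) k + _
            ≈⟨ +-congʳ (*-congʳ (≈-trans (⟦⟧-cong (≡.cong (λ n → + n ℚ./ 1) Aᵢₖ≡0)) 0#-homo)) ⟩
          0# * Y (suc j ℕ.* l) k + _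
            ≈⟨ ≈-trans (+-congʳ (zeroˡ _)) (+-identityˡ _) ⟩
          _ ∎

        wronskian : ℕ → Carrier
        wronskian n = s n * t (l ℕ.+ n) - t n * s (l ℕ.+ n)

        -- By periodicity the pairs (s , t) at times n and l + n undergo the same elementary
        -- operation of determinant 1, or none at all when the first entry is k.
        wronskian-step : ∀ n → wronskian (suc n) ≈ wronskian n
        wronskian-step n = begin-equality
          s (suc n) * t (l ℕ.+ suc n) - t (suc n) * s (l ℕ.+ suc n)
            ≡⟨ ≡.cong (λ m → s (suc n) * t m - t (suc n) * s m) (ℕ.+-suc l n) ⟩
          s (suc n) * t (suc n′) - t (suc n) * s (suc n′)
            ≈⟨ by-cases (edges-avoiding-target k (fst (e n)) (snd (e n)) (fst≢snd (e n)) (never n)) ⟩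
          wronskian n ∎
          where
          n′ : ℕ
          n′ = l ℕ.+ n
          e≡ : e n′ ≡ e n
          e≡ = ≡.trans (≡.cong e (ℕ.+-comm l n)) (periodic n)
          fixed : ∀ {i j} → fst (e n) ≡ j → i ≢ j → (Y (suc n) i ≈ Y n i) × (Y (suc n′) i ≈ Y n′ i)
          fixed refl i≢ = Y-other n _ i≢ ,
            Y-other n′ _ (λ eq → i≢ (≡.trans eq (≡.cong fst e≡)))
          reduced : ∀ {i j} → fst (e n) ≡ i → snd (e n) ≡ j →
                    (Y (suc n) i ≈ Y n i - Y n j) × (Y (suc n′) i ≈ Y n′ i - Y n′ j)
          reduced refl refl = Y-fst n ,
            ≡.subst (λ e′ → Y (suc n′) (fst e′) ≈ Y n′ (fst e′) - Y n′ (snd e′)) e≡ (Y-fst n′)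
          by-cases : ((fst (e n) ≡ a) × (snd (e n) ≡ b)) ⊎ ((fst (e n) ≡ b) × (snd (e n) ≡ a)) ⊎
                     (fst (e n) ≡ k) →
                     s (suc n) * t (suc n′) - t (suc n) * s (suc n′) ≈ wronskian n
          by-cases (inj₁ (f≡a , s≡b)) =
            let s≈ , s′≈ = reduced f≡a s≡b
                t≈ , t′≈ = fixed f≡a (λ eq → other₁≢other₂ k (≡.sym eq))
            in ≈-trans (+-cong (*-cong s≈ t′≈) (-‿cong (*-cong t≈ s′≈)))
                 (solve 4 (λ s t s′ t′ → (s :- t) :* t′ :- t :* (s′ :- t′) := s :* t′ :- t :* s′)
                    ≈-refl (s n) (t n) (s n′) (t n′))
          by-cases (inj₂ (inj₁ (f≡b , s≡a))) =
            let t≈ , t′≈ = reduced f≡b s≡a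
                s≈ , s′≈ = fixed f≡b (other₁≢other₂ k)
            in ≈-trans (+-cong (*-cong s≈ t′≈) (-‿cong (*-cong t≈ s′≈)))
                 (solve 4 (λ s t s′ t′ → s :* (t′ :- s′) :- (t :- s) :* s′ := s :* t′ :- t :* s′)
                    ≈-refl (s n) (t n) (s n′) (t n′))
          by-cases (inj₂ (inj₂ f≡k)) =
            let s≈ , s′≈ = fixed f≡k (other₁≢ k)
                t≈ , t′≈ = fixed f≡k (other₂≢ k)
            in +-cong (*-cong s≈ t′≈) (-‿cong (*-cong t≈ s′≈))

        wronskian-constant : ∀ n → wronskian n ≈ wronskian 0
        wronskian-constant zero    = ≈-refl
        wronskian-constant (suc n) = ≈-trans (wronskian-step n) (wronskian-constant n)

        private
          g : ℕ → Carrier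
          g j = s (j ℕ.* l) + t (j ℕ.* l)
          0<g : ∀ j → 0# < g j
          0<g j = +-pos (Y-pos _ a) (Y-pos _ b)
          g≤ : ∀ {i} → 0 ℕ.< A i a → 0 ℕ.< A i b → A i k ≡ 0 → ∀ j → g (suc j) ≤ Y (j ℕ.* l) i
          g≤ 0<Aᵢₐ 0<Aᵢᵦ Aᵢₖ≡0 j = ≤-trans
            (+-mono-≤ (x≤⌞n⌟*x 0<Aᵢₐ (Y-pos _ a)) (x≤⌞n⌟*x 0<Aᵢᵦ (Y-pos _ b)))
            (inj₂ (≈-sym (expand Aᵢₖ≡0 j)))
          -- All four entries of the block are at least 1, so each of s and t at the start of a
          -- period is at least the sum s + t at its end.
          2g≤g : ∀ j → g (suc j) + g (suc j) ≤ g j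
          2g≤g j = +-mono-≤ (g≤ (productM-diagonal e l a) 0<A₁₂ A₁ₖ≡0 j)
                            (g≤ 0<A₂₁ (productM-diagonal e l b) A₂ₖ≡0 j)
          g≤g₀ : ∀ j → g j ≤ g 0
          g≤g₀ zero    = ≤-refl
          g≤g₀ (suc j) = ≤-trans (≤-trans (x≤x+y (inj₁ (0<g (suc j)))) (2g≤g j)) (g≤g₀ j)

          -- Such a bound keeps `g (suc j)` above δ = w / g 0. Since g at least halves over a
          -- period, it would then also lose at least δ each time.
          ¬-wronskian-bound : ∀ {w} → 0# < w → ¬ (∀ j → w ≤ g (suc j) * g 0)
          ¬-wronskian-bound {w} 0<w w≤ = ¬-infinite-descent g (*-pos 0<w (⁻¹-pos (0<g 0))) 0<g λ j →
            ≤-trans (+-monoʳ-≤ (g (suc j)) (δ≤g j)) (2g≤g j)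
            where
            δ≤g : ∀ j → w / g 0 ≤ g (suc j)
            δ≤g j = *-cancelʳ-≤ (0<g 0) (begin
              w / g 0 * g 0         ≈⟨ x/y*y≈x (0<x⇒x≉0 (0<g 0)) ⟩
              w                     ≤⟨ w≤ j ⟩
              g (suc j) * g 0       ∎)

          x-y≤x : ∀ {x y} → 0# < y → x - y ≤ x
          x-y≤x {x} {y} 0<y = ≤-trans (x≤x+y (inj₁ 0<y))
            (inj₂ (solve 2 (λ x y → x :- y :+ y := x) ≈-refl x y))

          y≤x+y : ∀ {x y} → 0# ≤ x → y ≤ x + y
          y≤x+y 0≤x = ≤-trans (x≤x+y 0≤x) (inj₂ (+-comm _ _))

          product-bound : ∀ j {x y} → 0# < y → x ≤ g j → y ≤ g (suc j) → x * y ≤ g (suc j) * g 0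
          product-bound j {x} {y} 0<y x≤ y≤ = begin
            x * y             ≤⟨ *-mono-≤ (0<g 0) 0<y (≤-trans x≤ (g≤g₀ j)) y≤ ⟩
            g 0 * g (suc j)   ≈⟨ *-comm _ _ ⟩
            g (suc j) * g 0   ∎

          s≤g : ∀ j → s (j ℕ.* l) ≤ g j
          s≤g j = x≤x+y (inj₁ (Y-pos _ b))
          t≤g : ∀ j → t (j ℕ.* l) ≤ g j
          t≤g j = y≤x+y (inj₁ (Y-pos _ a))

        -- The Wronskian is a difference of two positive products, so its absolute value at time j l
        -- is at most the larger product, hence at most `g j * g (suc j)`. Being constant, it would
        -- give a fixed positive lower bound for `g (suc j) * g 0`, whichever its sign.
        wronskian≈0 : wronskian 0 ≈ 0#
        wronskian≈0 with compare (wronskian 0) 0#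
        ... | tri≈ _ w≈0 _ = w≈0
        ... | tri> _ _ 0<w = contradiction (λ j → begin
          wronskian 0                        ≈⟨ wronskian-constant (j ℕ.* l) ⟨
          wronskian (j ℕ.* l)                ≤⟨ x-y≤x (*-pos (Y-pos _ b) (Y-pos _ a)) ⟩
          s (j ℕ.* l) * t (suc j ℕ.* l)      ≤⟨ product-bound j (Y-pos _ b) (s≤g j) (t≤g (suc j)) ⟩
          g (suc j) * g 0                    ∎) (¬-wronskian-bound 0<w)
        ... | tri< w<0 _ _ = contradiction (λ j → begin
          - wronskian 0                      ≈⟨ -‿cong (wronskian-constant (j ℕ.* l)) ⟨
          - wronskian (j ℕ.* l)              ≈⟨ solve 2 (λ x y → :- (x :- y) := y :- x) ≈-refl _ _ ⟩
          t (j ℕ.* l) * s (suc j ℕ.* l) - s (j ℕ.* l) * t (suc j ℕ.* l)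
                                             ≤⟨ x-y≤x (*-pos (Y-pos _ a) (Y-pos _ b)) ⟩
          t (j ℕ.* l) * s (suc j ℕ.* l)      ≤⟨ product-bound j (Y-pos _ a) (t≤g j) (s≤g (suc j)) ⟩
          g (suc j) * g 0                    ∎) (¬-wronskian-bound (x<0⇒0<-x w<0))

        -- With vanishing Wronskian, (s , t) after one period is proportional to (s , t) at time 0,
        -- which is therefore an eigenvector of the block. Eliminating the eigenvalue leaves this
        -- quadratic form; the identity is proved after multiplication by the positive t′.
        quadratic-relation : ⌞ A b a ⌟ * (s 0 * s 0) + (⌞ A b b ⌟ - ⌞ A a a ⌟) * (s 0 * t 0)
                             + (- ⌞ A a b ⌟) * (t 0 * t 0) ≈ 0#
        quadratic-relation = x*y≈0⇒x≈0 (0<x⇒x≉0 (Y-pos (l ℕ.+ 0) b)) (begin-equality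
          (⌞ A b a ⌟ * (s 0 * s 0) + (⌞ A b b ⌟ - ⌞ A a a ⌟) * (s 0 * t 0) + (- ⌞ A a b ⌟) * (t 0 * t 0)) * t′
            ≈⟨ solve 8 (λ α β γ δ s t s′ t′ →
                 (γ :* (s :* s) :+ (δ :- α) :* (s :* t) :+ (:- β) :* (t :* t)) :* t′
                 := (s :* t′ :- t :* s′) :* (γ :* s :- α :* t)
                 :+ (t :* s :* (γ :* s′ :+ δ :* t′) :- t :* t :* (α :* s′ :+ β :* t′)))
                 ≈-refl ⌞ A a a ⌟ ⌞ A a b ⌟ ⌞ A b a ⌟ ⌞ A b b ⌟ (s 0) (t 0) s′ t′ ⟩
          wronskian 0 * (⌞ A b a ⌟ * s 0 - ⌞ A a a ⌟ * t 0)
            + (t 0 * s 0 * (⌞ A b a ⌟ * s′ + ⌞ A b b ⌟ * t′) - t 0 * t 0 * (⌞ A a a ⌟ * s′ + ⌞ A a b ⌟ * t′))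
            ≈⟨ +-cong (≈-trans (*-congʳ wronskian≈0) (zeroˡ _))
                 (+-cong (*-congˡ (≈-sym (expand A₂ₖ≡0 0))) (-‿cong (*-congˡ (≈-sym (expand A₁ₖ≡0 0))))) ⟩
          0# + (t 0 * s 0 * t 0 - t 0 * t 0 * s 0)
            ≈⟨ +-identityˡ _ ⟩
          t 0 * s 0 * t 0 - t 0 * t 0 * s 0
            ≈⟨ solve 2 (λ s t → t :* s :* t :- t :* t :* s := con 0ℚ) ≈-refl (s 0) (t 0) ⟩
          ι 0ℚ
            ≈⟨ 0#-homo ⟩
          0# ∎)
          where
          -- `1 ℕ.* l` computes to `l ℕ.+ 0`, so `expand` at j = 0 speaks of these same values.
          s′ t′ : Carrier
          s′ = s (l ℕ.+ 0)
          t′ = t (l ℕ.+ 0)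

-- The algorithm

third : Ind → Fin 3
third ⟨12⟩ = 0F
third ⟨21⟩ = 0F
third ⟨01⟩ = 2F
third ⟨10⟩ = 2F
third ⟨02⟩ = 1F
third ⟨20⟩ = 1F

≢fst⇒snd⊎third : ∀ e k → fst e ≢ k → (snd e ≡ k) ⊎ (third e ≡ k)
≢fst⇒snd⊎third ⟨12⟩ 0F _ = inj₂ refl
≢fst⇒snd⊎third ⟨12⟩ 1F ≢ = contradiction refl ≢
≢fst⇒snd⊎third ⟨12⟩ 2F _ = inj₁ refl
≢fst⇒snd⊎third ⟨21⟩ 0F _ = inj₂ refl
≢fst⇒snd⊎third ⟨21⟩ 1F _ = inj₁ refl
≢fst⇒snd⊎third ⟨21⟩ 2F ≢ = contradiction refl ≢
≢fst⇒snd⊎third ⟨01⟩ 0F ≢ = contradiction refl ≢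
≢fst⇒snd⊎third ⟨01⟩ 1F _ = inj₁ refl
≢fst⇒snd⊎third ⟨01⟩ 2F _ = inj₂ refl
≢fst⇒snd⊎third ⟨10⟩ 0F _ = inj₁ refl
≢fst⇒snd⊎third ⟨10⟩ 1F ≢ = contradiction refl ≢
≢fst⇒snd⊎third ⟨10⟩ 2F _ = inj₂ refl
≢fst⇒snd⊎third ⟨02⟩ 0F ≢ = contradiction refl ≢
≢fst⇒snd⊎third ⟨02⟩ 1F _ = inj₂ refl
≢fst⇒snd⊎third ⟨02⟩ 2F _ = inj₁ refl
≢fst⇒snd⊎third ⟨20⟩ 0F _ = inj₁ refl
≢fst⇒snd⊎third ⟨20⟩ 1F _ = inj₂ refl
≢fst⇒snd⊎third ⟨20⟩ 2F ≢ = contradiction refl ≢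

-- `pair′ e` keeps the first entry of `e` and replaces the second by `third e`; it is the competitor
-- against which the maximality of the chosen pair is used.
pair pair′ : Ind → Pair
pair ⟨12⟩ = ｛12｝
pair ⟨21⟩ = ｛12｝
pair ⟨01⟩ = ｛01｝
pair ⟨10⟩ = ｛01｝
pair ⟨02⟩ = ｛02｝
pair ⟨20⟩ = ｛02｝
pair′ ⟨12⟩ = ｛01｝
pair′ ⟨21⟩ = ｛02｝
pair′ ⟨01⟩ = ｛02｝
pair′ ⟨10⟩ = ｛12｝
pair′ ⟨02⟩ = ｛01｝
pair′ ⟨20⟩ = ｛12｝

-- One step in barycentric coordinates

module OneStep {c ℓ₁ ℓ₂ k} (R : RealField c ℓ₁ ℓ₂) (F : CubicField R k)
             (p q : ℕ) .{{_ : NonZero p}} .{{_ : NonZero q}} where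
  open RealField R
  open RealFieldProperties R
  open CubicField F
  open OrderedField R
  open Norm R F
  open Algorithm R F p q
  open ΔK
  open Solver using (solve; _:=_; _:+_; _:*_; _:-_; :-_; con)
  open ≤-Reasoning

  barycentric : Carrier × Carrier → Fin 3 → Carrier
  barycentric (x , y) 0F = 1# - x - y
  barycentric (x , y) 1F = x
  barycentric (x , y) 2F = y

  X : ΔK → Fin 3 → Carrier
  X P = barycentric (point P)

  X∈K : ∀ P i → X P i ∈ K
  X∈K P 0F = γ∈K P
  X∈K P 1F = α∈K P
  X∈K P 2F = β∈K P

  X-pos : ∀ P i → 0# < X P i
  X-pos P 0F = 0<γ P
  X-pos P 1F = 0<α P
  X-pos P 2F = 0<β P

  -- In all six cases this is 1 minus the barycentric coordinate at `snd e`, that is, the sum of the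
  -- coordinates after the subtraction.
  denominator : Ind → Carrier × Carrier → Carrier
  denominator ⟨12⟩ (x , y) = 1# - y
  denominator ⟨21⟩ (x , y) = 1# - x
  denominator ⟨01⟩ (x , y) = 1# - x
  denominator ⟨10⟩ (x , y) = x + y
  denominator ⟨02⟩ (x , y) = 1# - y
  denominator ⟨20⟩ (x , y) = x + y

  denominator∈K : ∀ P e → denominator e (point P) ∈ K
  denominator∈K P ⟨12⟩ = +-closed 1∈K (-‿closed (β∈K P))
  denominator∈K P ⟨21⟩ = +-closed 1∈K (-‿closed (α∈K P))
  denominator∈K P ⟨01⟩ = +-closed 1∈K (-‿closed (α∈K P))
  denominator∈K P ⟨10⟩ = +-closed (α∈K P) (β∈K P)
  denominator∈K P ⟨02⟩ = +-closed 1∈K (-‿closed (β∈K P))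
  denominator∈K P ⟨20⟩ = +-closed (α∈K P) (β∈K P)

  denominator-pos : ∀ P e → 0# < denominator e (point P)
  denominator-pos P = λ where
      ⟨12⟩ → 0<1-β
      ⟨21⟩ → 0<1-α
      ⟨01⟩ → 0<1-α
      ⟨10⟩ → +-pos (0<α P) (0<β P)
      ⟨02⟩ → 0<1-β
      ⟨20⟩ → +-pos (0<α P) (0<β P)
    where
    0<1-α : 0# < 1# - α P
    0<1-α = <-respʳ-≈ (solve 3 (λ o x y → (o :- x :- y) :+ y := o :- x) ≈-refl 1# (α P) (β P))
                      (+-pos (0<γ P) (0<β P))
    0<1-β : 0# < 1# - β P
    0<1-β = <-respʳ-≈ (solve 3 (λ o x y → (o :- x :- y) :+ x := o :- y) ≈-refl 1# (α P) (β P))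
                      (+-pos (0<γ P) (0<α P))

  reduce : Ind → (Fin 3 → Carrier) → Fin 3 → Carrier
  reduce e z i with i Fin.≟ fst e
  ... | yes _ = z i - z (snd e)
  ... | no _  = z i

  reduce-fst : ∀ e z → reduce e z (fst e) ≈ z (fst e) - z (snd e)
  reduce-fst e z with fst e Fin.≟ fst e
  ... | yes _ = ≈-refl
  ... | no ≢  = contradiction refl ≢

  reduce-other : ∀ e z i → i ≢ fst e → reduce e z i ≈ z i
  reduce-other e z i i≢ with i Fin.≟ fst e
  ... | yes eq = contradiction eq i≢
  ... | no _   = ≈-refl

  module _ {D : Carrier} (0<D : 0# < D) where
    private
      cancel : ∀ z → D * (z / D) ≈ z
      cancel z = begin-equality
        D * (z * D ⁻¹)   ≈⟨ solve 3 (λ d z i → d :* (z :* i) := z :* (d :* i)) ≈-refl D z (D ⁻¹) ⟩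
        z * (D * D ⁻¹)   ≈⟨ *-congˡ (⁻¹-inverseʳ (0<x⇒x≉0 0<D)) ⟩
        z * 1#           ≈⟨ *-identityʳ z ⟩
        z                ∎

    scaled-barycentric : ∀ {a b} (w : Fin 3 → Carrier) → a ≈ w 1F → b ≈ w 2F → D ≈ w 0F + (w 1F + w 2F) →
                         ∀ i → D * barycentric (a / D , b / D) i ≈ w i
    scaled-barycentric {a} {b} w a≈ b≈ D≈ 0F = begin-equality
      D * (1# - a / D - b / D)
        ≈⟨ solve 4 (λ d o a b → d :* (o :- a :- b) := d :* o :- d :* a :- d :* b) ≈-refl D 1# (a / D) (b / D) ⟩
      D * 1# - D * (a / D) - D * (b / D)
        ≈⟨ +-cong (+-cong (≈-trans (*-identityʳ D) D≈) (-‿cong (≈-trans (cancel a) a≈)))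
                  (-‿cong (≈-trans (cancel b) b≈)) ⟩
      w 0F + (w 1F + w 2F) - w 1F - w 2F
        ≈⟨ solve 3 (λ x y z → x :+ (y :+ z) :- y :- z := x) ≈-refl (w 0F) (w 1F) (w 2F) ⟩
      w 0F ∎
    scaled-barycentric {a} {b} w a≈ b≈ D≈ 1F = ≈-trans (cancel a) a≈
    scaled-barycentric {a} {b} w a≈ b≈ D≈ 2F = ≈-trans (cancel b) b≈

  -- Each of the six maps is one subtraction of barycentric coordinates followed by division by the
  -- new sum; multiplying by that sum leaves the bare subtraction.
  T-reduce : ∀ e x y → 0# < denominator e (x , y) →
             ∀ i → denominator e (x , y) * barycentric (T⟨ e ⟩ (x , y)) i ≈ reduce e (barycentric (x , y)) i
  T-reduce ⟨12⟩ x y 0<D =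
    scaled-barycentric 0<D (reduce ⟨12⟩ (barycentric (x , y))) ≈-refl ≈-refl
    (solve 3 (λ o x y → o :- y := (o :- x :- y) :+ ((x :- y) :+ y)) ≈-refl 1# x y)
  T-reduce ⟨21⟩ x y 0<D =
    scaled-barycentric 0<D (reduce ⟨21⟩ (barycentric (x , y))) ≈-refl ≈-refl
    (solve 3 (λ o x y → o :- x := (o :- x :- y) :+ (x :+ (y :- x))) ≈-refl 1# x y)
  T-reduce ⟨01⟩ x y 0<D =
    scaled-barycentric 0<D (reduce ⟨01⟩ (barycentric (x , y))) ≈-refl ≈-refl
    (solve 3 (λ o x y → o :- x := (o :- x :- y :- x) :+ (x :+ y)) ≈-refl 1# x y)
  T-reduce ⟨10⟩ x y 0<D =
    scaled-barycentric 0<D (reduce ⟨10⟩ (barycentric (x , y)))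
    (solve 3 (λ o x y → con 2ℚ :* x :+ y :- o := x :- (o :- x :- y)) ≈-refl 1# x y) ≈-refl
    (solve 3 (λ o x y → x :+ y := (o :- x :- y) :+ ((x :- (o :- x :- y)) :+ y)) ≈-refl 1# x y)
  T-reduce ⟨02⟩ x y 0<D =
    scaled-barycentric 0<D (reduce ⟨02⟩ (barycentric (x , y))) ≈-refl ≈-refl
    (solve 3 (λ o x y → o :- y := (o :- x :- y :- y) :+ (x :+ y)) ≈-refl 1# x y)
  T-reduce ⟨20⟩ x y 0<D =
    scaled-barycentric 0<D (reduce ⟨20⟩ (barycentric (x , y))) ≈-refl
    (solve 3 (λ o x y → x :+ con 2ℚ :* y :- o := y :- (o :- x :- y)) ≈-refl 1# x y)
    (solve 3 (λ o x y → x :+ y := (o :- x :- y) :+ (x :+ (y :- (o :- x :- y)))) ≈-refl 1# x y)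

  ρ : ∀ P i → Carrier
  ρ P i = X-pos P i ^r

  ρ-pos : ∀ P i → 0# < ρ P i
  ρ-pos P i = proj₁ (proj₂ (root q (^-pos p (X-pos P i))))

  ρ^q≈X^p : ∀ P i → ρ P i ^ q ≈ X P i ^ p
  ρ^q≈X^p P i = proj₂ (proj₂ (root q (^-pos p (X-pos P i))))

  ∣NX∣ : ∀ P i → Carrier
  ∣NX∣ P i = ∣N∣ (X∈K P i)

  ∣NX∣-pos : ∀ P i → 0# < ∣NX∣ P i
  ∣NX∣-pos P i = ∣N∣-pos (X∈K P i) (X-pos P i)

  -- The weight of a single coordinate. Since the norm is multiplicative in absolute value, `v` of a
  -- pair is the product of two weights, and pairs sharing an index are compared by one weight each.
  U : ΔK → Fin 3 → Carrier
  U P i = ρ P i / ∣NX∣ P i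

  U-pos : ∀ P i → 0# < U P i
  U-pos P i = *-pos (ρ-pos P i) (⁻¹-pos (∣NX∣-pos P i))

  U*∣NX∣≈ρ : ∀ P i → U P i * ∣NX∣ P i ≈ ρ P i
  U*∣NX∣≈ρ P i = x/y*y≈x (0<x⇒x≉0 (∣NX∣-pos P i))

  vᵢⱼ≈UᵢUⱼ : ∀ P i j →
    (ρ P i * ρ P j) / ι ℚ.∣ norm (X∈K P i) ℚ.* norm (X∈K P j) ∣ ≈ U P i * U P j
  vᵢⱼ≈UᵢUⱼ P i j = *-cancelʳ-≈ 0<N (begin-equality
    (ρ P i * ρ P j) / N * N
      ≈⟨ x/y*y≈x (0<x⇒x≉0 0<N) ⟩
    ρ P i * ρ P j
      ≈⟨ *-cong (U*∣NX∣≈ρ P i) (U*∣NX∣≈ρ P j) ⟨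
    U P i * ∣NX∣ P i * (U P j * ∣NX∣ P j)
      ≈⟨ solve 4 (λ u m v n → u :* m :* (v :* n) := u :* v :* (m :* n)) ≈-refl
           (U P i) (∣NX∣ P i) (U P j) (∣NX∣ P j) ⟩
    U P i * U P j * (∣NX∣ P i * ∣NX∣ P j)
      ≈⟨ *-congˡ N≈ ⟨
    U P i * U P j * N ∎)
    where
    N : Carrier
    N = ι ℚ.∣ norm (X∈K P i) ℚ.* norm (X∈K P j) ∣
    N≈ : N ≈ ∣NX∣ P i * ∣NX∣ P j
    N≈ = ≈-trans (⟦⟧-cong (ℚ.∣p*q∣≡∣p∣*∣q∣ (norm (X∈K P i)) (norm (X∈K P j)))) (*-homo _ _)
    0<N : 0# < N
    0<N = <-respʳ-≈ (≈-sym N≈) (*-pos (∣NX∣-pos P i) (∣NX∣-pos P j))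

  v-pair : ∀ P e → v (pair e) P ≈ U P (snd e) * U P (fst e)
  v-pair P ⟨12⟩ = ≈-trans (vᵢⱼ≈UᵢUⱼ P 1F 2F) (*-comm _ _)
  v-pair P ⟨21⟩ = vᵢⱼ≈UᵢUⱼ P 1F 2F
  v-pair P ⟨01⟩ = vᵢⱼ≈UᵢUⱼ P 1F 0F
  v-pair P ⟨10⟩ = ≈-trans (vᵢⱼ≈UᵢUⱼ P 1F 0F) (*-comm _ _)
  v-pair P ⟨02⟩ = vᵢⱼ≈UᵢUⱼ P 2F 0F
  v-pair P ⟨20⟩ = ≈-trans (vᵢⱼ≈UᵢUⱼ P 2F 0F) (*-comm _ _)

  v-pair′ : ∀ P e → v (pair′ e) P ≈ U P (third e) * U P (fst e)
  v-pair′ P ⟨12⟩ = ≈-trans (vᵢⱼ≈UᵢUⱼ P 1F 0F) (*-comm _ _)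
  v-pair′ P ⟨21⟩ = ≈-trans (vᵢⱼ≈UᵢUⱼ P 2F 0F) (*-comm _ _)
  v-pair′ P ⟨01⟩ = vᵢⱼ≈UᵢUⱼ P 2F 0F
  v-pair′ P ⟨10⟩ = ≈-trans (vᵢⱼ≈UᵢUⱼ P 1F 2F) (*-comm _ _)
  v-pair′ P ⟨02⟩ = vᵢⱼ≈UᵢUⱼ P 1F 0F
  v-pair′ P ⟨20⟩ = vᵢⱼ≈UᵢUⱼ P 1F 2F

  pair-ε-on : ∀ P s → pair (proj₁ (ε-on P s)) ≡ s
  pair-ε-on P ｛12｝ with β P ≤? α P
  ... | yes _ = refl
  ... | no _  = refl
  pair-ε-on P ｛01｝ with (2# * α P + β P - 1#) ≤? 0#
  ... | yes _ = refl
  ... | no _  = refl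
  pair-ε-on P ｛02｝ with (α P + 2# * β P - 1#) ≤? 0#
  ... | yes _ = refl
  ... | no _  = refl

  U-third≤U-snd : ∀ P → U P (third (ε P)) ≤ U P (snd (ε P))
  U-third≤U-snd P = *-cancelʳ-≤ (U-pos P (fst (ε P))) (begin
    U P (third (ε P)) * U P (fst (ε P))  ≈⟨ v-pair′ P (ε P) ⟨
    v (pair′ (ε P)) P                    ≤⟨ maxPair-max P (pair′ (ε P)) ⟩
    v (maxPair P) P                      ≡⟨ ≡.cong (λ s → v s P) (pair-ε-on P (maxPair P)) ⟨
    v (pair (ε P)) P                     ≈⟨ v-pair P (ε P) ⟩
    U P (snd (ε P)) * U P (fst (ε P))    ∎)

  -- The q-th power of the weight comparison removes the roots, because the q-th power of `ρ` is the
  -- p-th power of `X`. What remains has integer exponents only.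
  X-inequality : ∀ P → X P (third (ε P)) ^ p * ∣NX∣ P (snd (ε P)) ^ q
                     ≤ X P (snd (ε P)) ^ p * ∣NX∣ P (third (ε P)) ^ q
  X-inequality P = begin
    X P t ^ p * ∣NX∣ P s ^ q    ≈⟨ power t s ⟩
    (ρ P t * ∣NX∣ P s) ^ q      ≤⟨ ^-monoˡ-≤ q (*-pos (ρ-pos P t) (∣NX∣-pos P s)) ρN≤ ⟩
    (ρ P s * ∣NX∣ P t) ^ q      ≈⟨ power s t ⟨
    X P s ^ p * ∣NX∣ P t ^ q    ∎
    where
    s t : Fin 3
    s = snd (ε P)
    t = third (ε P)
    power : ∀ i j → X P i ^ p * ∣NX∣ P j ^ q ≈ (ρ P i * ∣NX∣ P j) ^ q
    power i j = ≈-trans (*-congʳ (≈-sym (ρ^q≈X^p P i))) (≈-sym (^-distrib-* (ρ P i) (∣NX∣ P j) q))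
    ρN≤ : ρ P t * ∣NX∣ P s ≤ ρ P s * ∣NX∣ P t
    ρN≤ = begin
      ρ P t * ∣NX∣ P s                     ≈⟨ *-congʳ (U*∣NX∣≈ρ P t) ⟨
      U P t * ∣NX∣ P t * ∣NX∣ P s          ≈⟨ *-assoc _ _ _ ⟩
      U P t * (∣NX∣ P t * ∣NX∣ P s)        ≤⟨ *-monoˡ-≤ (*-pos (∣NX∣-pos P t) (∣NX∣-pos P s)) (U-third≤U-snd P) ⟩
      U P s * (∣NX∣ P t * ∣NX∣ P s)        ≈⟨ solve 3 (λ u t s → u :* (t :* s) := u :* s :* t) ≈-refl
                                                (U P s) (∣NX∣ P t) (∣NX∣ P s) ⟩
      U P s * ∣NX∣ P s * ∣NX∣ P t          ≈⟨ *-congʳ (U*∣NX∣≈ρ P s) ⟩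
      ρ P s * ∣NX∣ P t                     ∎

  -- Substituting γ = 1 - α - β turns a relation between two barycentric coordinates into one among
  -- 1, α and β, from which both coefficients can be read off.
  X-independent : ∀ P k {u w} → ι u * X P (other₁ k) + ι w * X P (other₂ k) ≈ 0# →
                  (u ≡ 0ℚ) × (w ≡ 0ℚ)
  X-independent P 0F {u} {w} eq =
    let _ , u≡0 , w≡0 = Preservation.independent₃ P 0ℚ u w (≈-trans
          (solve 5 (λ o x y u w → con 0ℚ :* o :+ u :* x :+ w :* y := u :* x :+ w :* y)
             ≈-refl 1# (α P) (β P) (ι u) (ι w)) eq)
    in u≡0 , w≡0
  X-independent P 1F {u} {w} eq =
    let u≡0 , _ , w-u≡0 = Preservation.independent₃ P u (ℚ.- u) (w ℚ.- u) (≈-trans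
          (+-cong (+-congˡ (*-congʳ (-‿homo u))) (*-congʳ (ι-sub w u))) (≈-trans
          (solve 5 (λ o x y u w → u :* o :+ (:- u) :* x :+ (w :- u) :* y := u :* (o :- x :- y) :+ w :* y)
             ≈-refl 1# (α P) (β P) (ι u) (ι w)) eq))
    in u≡0 , ≡.trans (p-q≡0⇒p≡q w-u≡0) u≡0
  X-independent P 2F {u} {w} eq =
    let u≡0 , w-u≡0 , _ = Preservation.independent₃ P u (w ℚ.- u) (ℚ.- u) (≈-trans
          (+-cong (+-congˡ (*-congʳ (ι-sub w u))) (*-congʳ (-‿homo u))) (≈-trans
          (solve 5 (λ o x y u w → u :* o :+ (w :- u) :* x :+ (:- u) :* y := u :* (o :- x :- y) :+ w :* x)
             ≈-refl 1# (α P) (β P) (ι u) (ι w)) eq))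
    in u≡0 , ≡.trans (p-q≡0⇒p≡q w-u≡0) u≡0

  -- The interface through which the orbit argument sees the algorithm: a projective subtraction,
  -- with a scaling factor in K, and the inequality forced by the choice of the pair.
  record Step (P : ΔK) (e : Ind) (P′ : ΔK) : Set (ℓ₁ ⊔ ℓ₂ ⊔ c ⊔ k) where
    field
      D          : Carrier
      D∈K        : D ∈ K
      D-pos      : 0# < D
      X-reduce   : ∀ i → D * X P′ i ≈ reduce e (X P) i
      inequality : X P (third e) ^ p * ∣NX∣ P (snd e) ^ q ≤ X P (snd e) ^ p * ∣NX∣ P (third e) ^ q

  T-step : ∀ P → Step P (ε P) (T P)
  T-step P = record
    { D          = denominator (ε P) (point P)
    ; D∈K        = denominator∈K P (ε P)
    ; D-pos      = denominator-pos P (ε P)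
    ; X-reduce   = T-reduce (ε P) (α P) (β P) (denominator-pos P (ε P))
    ; inequality = X-inequality P
    }

-- The orbit without normalisation

module Orbit {c ℓ₁ ℓ₂ k} (R : RealField c ℓ₁ ℓ₂) (F : CubicField R k)
             (p q : ℕ) .{{_ : NonZero p}} .{{_ : NonZero q}}
             (P : ℕ → Algorithm.ΔK R F p q) (e : ℕ → Ind)
             (step : ∀ n → OneStep.Step R F p q (P n) (e n) (P (suc n))) where
  open RealField R
  open RealFieldProperties R
  open CubicField F
  open OrderedField R
  open Norm R F
  open Quadratic R F
  open Dynamics R using (module Subtractive)
  open OneStep R F p q
  open Solver using (solve; _:=_; _:+_; _:*_; _:-_; :-_; con)
  open ≤-Reasoning
  module Step′ n = Step (step n)

  -- The accumulated product of denominators, which undoes all normalisations up to time n.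
  scale : ℕ → Carrier
  scale zero    = 1#
  scale (suc n) = scale n * Step′.D n

  scale∈K : ∀ n → scale n ∈ K
  scale∈K zero    = 1∈K
  scale∈K (suc n) = *-closed (scale∈K n) (Step′.D∈K n)

  scale-pos : ∀ n → 0# < scale n
  scale-pos zero    = 0<1
  scale-pos (suc n) = *-pos (scale-pos n) (Step′.D-pos n)

  Y : ℕ → Fin 3 → Carrier
  Y n i = scale n * X (P n) i

  Y∈K : ∀ n i → Y n i ∈ K
  Y∈K n i = *-closed (scale∈K n) (X∈K (P n) i)

  Y-pos : ∀ n i → 0# < Y n i
  Y-pos n i = *-pos (scale-pos n) (X-pos (P n) i)

  Y-reduce : ∀ n i → Y (suc n) i ≈ scale n * reduce (e n) (X (P n)) i
  Y-reduce n i = ≈-trans (*-assoc _ _ _) (*-congˡ (Step′.X-reduce n i))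

  Y-fst : ∀ n → Y (suc n) (fst (e n)) ≈ Y n (fst (e n)) - Y n (snd (e n))
  Y-fst n = ≈-trans (Y-reduce n (fst (e n))) (≈-trans (*-congˡ (reduce-fst (e n) (X (P n))))
    (solve 3 (λ s x y → s :* (x :- y) := s :* x :- s :* y) ≈-refl _ _ _))

  Y-other : ∀ n i → i ≢ fst (e n) → Y (suc n) i ≈ Y n i
  Y-other n i i≢ = ≈-trans (Y-reduce n i) (*-congˡ (reduce-other (e n) (X (P n)) i i≢))

  -- Without normalisation the steps only subtract coordinates, so one d chosen at time 0 serves for
  -- all times.
  Y-integral : ∀ {d} → (∀ i → IntegralMultiple d (Y∈K 0 i)) → ∀ n i → IntegralMultiple d (Y∈K n i)
  Y-integral h zero i = h i
  Y-integral {d} h (suc n) i = by-cases (i Fin.≟ fst (e n))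
    where
    by-cases : Dec (i ≡ fst (e n)) → IntegralMultiple d (Y∈K (suc n) i)
    by-cases (yes refl) = integralMultiple-sub {d} (Y∈K n i) (Y∈K n (snd (e n))) (Y∈K (suc n) i)
      (Y-fst n) (Y-integral {d} h n i) (Y-integral {d} h n (snd (e n)))
    by-cases (no i≢) = integralMultiple-cong {d} (Y∈K n i) (Y∈K (suc n) i)
      (≈-sym (Y-other n i i≢)) (Y-integral {d} h n i)

  ∣NY∣ : ℕ → Fin 3 → Carrier
  ∣NY∣ n i = ∣N∣ (Y∈K n i)

  ∣NY∣-pos : ∀ n i → 0# < ∣NY∣ n i
  ∣NY∣-pos n i = ∣N∣-pos (Y∈K n i) (Y-pos n i)

  -- Both sides are homogeneous in the same way: a common factor z of the coordinates multiplies
  -- each by zᵖ |N(z)|^q.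
  Y-inequality : ∀ n → let s = snd (e n); t = third (e n) in
    Y n t ^ p * ∣NY∣ n s ^ q ≤ Y n s ^ p * ∣NY∣ n t ^ q
  Y-inequality n = begin
    Y n t ^ p * ∣NY∣ n s ^ q                               ≈⟨ homogeneous t s ⟩
    X (P n) t ^ p * ∣NX∣ (P n) s ^ q * C       ≤⟨ *-monoˡ-≤ 0<C (Step′.inequality n) ⟩
    X (P n) s ^ p * ∣NX∣ (P n) t ^ q * C       ≈⟨ homogeneous s t ⟨
    Y n s ^ p * ∣NY∣ n t ^ q                               ∎
    where
    s t : Fin 3
    s = snd (e n)
    t = third (e n)
    C : Carrier
    C = scale n ^ p * ∣N∣ (scale∈K n) ^ q
    0<C : 0# < C
    0<C = *-pos (^-pos p (scale-pos n)) (^-pos q (∣N∣-pos (scale∈K n) (scale-pos n)))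
    homogeneous : ∀ i j → Y n i ^ p * ∣NY∣ n j ^ q
                        ≈ X (P n) i ^ p * ∣NX∣ (P n) j ^ q * C
    homogeneous i j = begin-equality
      Y n i ^ p * ∣NY∣ n j ^ q
        ≈⟨ *-cong (^-distrib-* (scale n) (X (P n) i) p)
             (≈-trans (^-congˡ q (∣N∣-* (scale∈K n) (X∈K (P n) j) (Y∈K n j) ≈-refl))
                      (^-distrib-* (∣N∣ (scale∈K n)) (∣NX∣ (P n) j) q)) ⟩
      _
        ≈⟨ solve 4 (λ a b c d → a :* b :* (c :* d) := b :* d :* (a :* c)) ≈-refl _ _ _ _ ⟩
      _ ∎

  private
    module S = Subtractive e Y Y-pos Y-fst Y-other

  -- Every index occurs as a first entry

  module _ (k : Fin 3) (never : ∀ n → fst (e n) ≢ k) where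
    private
      d = proj₁ (integralMultiple-exists (Y 0) (Y∈K 0))
      0<d = proj₁ (proj₂ (integralMultiple-exists (Y 0) (Y∈K 0)))
      Y₀-integral = proj₂ (proj₂ (integralMultiple-exists (Y 0) (Y∈K 0)))
      d³ κ V E : Carrier
      d³ = d · 1# * (d · 1# * d · 1#)
      κ = Y 0 k
      V = ∣NY∣ 0 k
      E = V ^ q * d³ ^ q
      0<d·1 : 0# < d · 1#
      0<d·1 = ·-pos d {{ℕ.>-nonZero 0<d}} 0<1
      0<d³ : 0# < d³
      0<d³ = *-pos 0<d·1 (*-pos 0<d·1 0<d·1)
      0<E : 0# < E
      0<E = *-pos (^-pos q (∣NY∣-pos 0 k)) (^-pos q 0<d³)
      0<κ^p : 0# < κ ^ p
      0<κ^p = ^-pos p (Y-pos 0 k)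
      1≤[d³∣NY∣]^q : ∀ n i → 1# ≤ (d³ * ∣NY∣ n i) ^ q
      1≤[d³∣NY∣]^q n i = ≤-trans (inj₂ (≈-sym (1^n≈1 q))) (^-monoˡ-≤ q 0<1
        (integralMultiple⇒1≤ {d} (Y∈K n i) 0<d (Y-pos n i) (Y-integral {d} Y₀-integral n i)))

      -- In `Y-inequality` the coordinate at k is constantly `κ` with norm `V` in absolute value,
      -- while d³ |N| of the subtracted coordinate is at least 1. Solving for that coordinate gives
      -- the constant κᵖ / (V^q d^(3q)).
      lower-bound : ∀ n → third (e n) ≡ k → κ ^ p / E ≤ Y n (snd (e n)) ^ p
      lower-bound n refl = *-cancelʳ-≤ 0<E (begin
        κ ^ p / E * E
          ≈⟨ x/y*y≈x (0<x⇒x≉0 0<E) ⟩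
        κ ^ p
          ≈⟨ *-identityˡ _ ⟨
        1# * κ ^ p
          ≤⟨ *-monoˡ-≤ 0<κ^p (1≤[d³∣NY∣]^q n s) ⟩
        (d³ * ∣NY∣ n s) ^ q * κ ^ p
          ≈⟨ *-cong (^-distrib-* d³ (∣NY∣ n s) q) (^-congˡ p (≈-sym (S.never-source⇒constant k never n))) ⟩
        d³ ^ q * ∣NY∣ n s ^ q * Y n k ^ p
          ≈⟨ solve 3 (λ a b c → a :* b :* c := c :* b :* a) ≈-refl _ _ _ ⟩
        Y n k ^ p * ∣NY∣ n s ^ q * d³ ^ q
          ≤⟨ *-monoˡ-≤ (^-pos q 0<d³) (Y-inequality n) ⟩
        Y n s ^ p * ∣NY∣ n k ^ q * d³ ^ q
          ≈⟨ *-assoc _ _ _ ⟩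
        Y n s ^ p * (∣NY∣ n k ^ q * d³ ^ q)
          ≈⟨ *-congˡ (*-congʳ (^-congˡ q (∣N∣-cong (Y∈K n k) (Y∈K 0 k) (S.never-source⇒constant k never n)))) ⟩
        Y n s ^ p * E ∎)
        where
        s : Fin 3
        s = snd (e n)

      -- When k is subtracted, the amount is `κ`. Otherwise only the p-th power is bounded: a value
      -- y ≤ 1 satisfies yᵖ ≤ y and inherits the bound, and a larger y exceeds 1.
      step-bound : ∀ {δ} → δ ≤ 1# → δ ≤ κ ^ p / E → δ ≤ κ → ∀ n →
                   (snd (e n) ≡ k) ⊎ (third (e n) ≡ k) → Dec (Y n (snd (e n)) ≤ 1#) →
                   δ ≤ Y n (snd (e n))
      step-bound δ≤1 δ≤η δ≤κ n (inj₁ refl) _ =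
        ≤-trans δ≤κ (inj₂ (≈-sym (S.never-source⇒constant k never n)))
      step-bound δ≤1 δ≤η δ≤κ n (inj₂ t≡k) (yes y≤1) =
        ≤-trans δ≤η (≤-trans (lower-bound n t≡k) (x≤1⇒x^n≤x p (Y-pos n (snd (e n))) y≤1))
      step-bound δ≤1 δ≤η δ≤κ n (inj₂ t≡k) (no y≰1) = ≤-trans δ≤1 (≰⇒≥ y≰1)

    ¬-never-source : ⊥
    ¬-never-source =
      -- δ is a positive lower bound of 1, κᵖ / E and κ, one for each case of `step-bound`.
      let δ₁ , 0<δ₁ , δ₁≤1 , δ₁≤η = positiveLowerBound 0<1 (*-pos 0<κ^p (⁻¹-pos 0<E))
          δ , 0<δ , δ≤δ₁ , δ≤κ = positiveLowerBound 0<δ₁ (Y-pos 0 k)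
      in S.¬-bounded-below 0<δ λ n →
           step-bound (≤-trans δ≤δ₁ δ₁≤1) (≤-trans δ≤δ₁ δ₁≤η) δ≤κ n
             (≢fst⇒snd⊎third (e n) k (never n)) (Y n (snd (e n)) ≤? 1#)

  -- Rows and columns of the product over a period

  module _ {l} (0<l : 0 ℕ.< l) (periodic : ∀ n → e (n ℕ.+ l) ≡ e n) where
    private
      A : Matrix
      A = productM e l

      0<⊎≡0 : ∀ n → (0 ℕ.< n) ⊎ (n ≡ 0)
      0<⊎≡0 zero    = inj₂ refl
      0<⊎≡0 (suc n) = inj₁ ℕ.z<s

    productM-row : ∀ k → (0 ℕ.< A k (other₁ k)) ⊎ (0 ℕ.< A k (other₂ k))
    productM-row k with 0<⊎≡0 (A k (other₁ k)) | 0<⊎≡0 (A k (other₂ k))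
    ... | inj₁ 0<a | _        = inj₁ 0<a
    ... | inj₂ _   | inj₁ 0<a = inj₂ 0<a
    ... | inj₂ a≡0 | inj₂ b≡0 =
      contradiction (zero-row⇒never-source 0<l periodic k a≡0 b≡0) (¬-never-source k)

    -- The row condition makes the block on the other two indices positive, so the Wronskian
    -- argument applies. Its quadratic relation has leading coefficient `a₂₁` ≠ 0, which two
    -- independent elements of a cubic field cannot satisfy.
    ¬-zero-column : ∀ k → A (other₁ k) k ≡ 0 → A (other₂ k) k ≡ 0 → ⊥
    ¬-zero-column k A₁ₖ≡0 A₂ₖ≡0 =
      no-quadratic-relation (Y∈K 0 (other₁ k)) (Y∈K 0 (other₂ k)) Y-independent
      {a₂₁} (a₂₂ ℚ.- a₁₁) (ℚ.- a₁₂) a₂₁≢0 (begin-equality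
        _
          ≈⟨ +-cong (+-congˡ (*-congʳ (ι-sub a₂₂ a₁₁))) (*-congʳ (-‿homo a₁₂)) ⟩
        _
          ≈⟨ S.Periodic.quadratic-relation l periodic k (zero-column⇒never-target 0<l periodic k A₁ₖ≡0 A₂ₖ≡0)
               A₁ₖ≡0 A₂ₖ≡0 0<A₁₂ 0<A₂₁ ⟩
        0# ∎)
      where
      a₁₁ a₁₂ a₂₁ a₂₂ : ℚ
      a₁₁ = ℤ.+ A (other₁ k) (other₁ k) ℚ./ 1
      a₁₂ = ℤ.+ A (other₁ k) (other₂ k) ℚ./ 1
      a₂₁ = ℤ.+ A (other₂ k) (other₁ k) ℚ./ 1
      a₂₂ = ℤ.+ A (other₂ k) (other₂ k) ℚ./ 1
      0<A₁₂ : 0 ℕ.< A (other₁ k) (other₂ k)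
      0<A₁₂ = other₁→other₂ {A} (productM-diagonal e l) productM-row k A₁ₖ≡0
      0<A₂₁ : 0 ℕ.< A (other₂ k) (other₁ k)
      0<A₂₁ = other₂→other₁ {A} (productM-diagonal e l) productM-row k A₂ₖ≡0
      a₂₁≢0 : ¬ (a₂₁ ≡ 0ℚ)
      a₂₁≢0 a₂₁≡0 = 0<x⇒x≉0 (·-pos (A (other₂ k) (other₁ k)) {{ℕ.>-nonZero 0<A₂₁}} 0<1)
        (≈-trans (≈-sym (ι[n/1] (A (other₂ k) (other₁ k)))) (≈-trans (⟦⟧-cong a₂₁≡0) 0#-homo))
      Y-independent : ∀ u w → ι u * Y 0 (other₁ k) + ι w * Y 0 (other₂ k) ≈ 0# → (u ≡ 0ℚ) × (w ≡ 0ℚ)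
      -- `scale 0` is `1#`, so `Y 0` agrees with the barycentric coordinates of `P 0`.
      Y-independent u w eq = X-independent (P 0) k (≈-trans
        (+-cong (*-congˡ (≈-sym (*-identityˡ _))) (*-congˡ (≈-sym (*-identityˡ _)))) eq)

    productM-column : ∀ k → (0 ℕ.< A (other₁ k) k) ⊎ (0 ℕ.< A (other₂ k) k)
    productM-column k with 0<⊎≡0 (A (other₁ k) k) | 0<⊎≡0 (A (other₂ k) k)
    ... | inj₁ 0<a | _        = inj₁ 0<a
    ... | inj₂ _   | inj₁ 0<a = inj₂ 0<a
    ... | inj₂ a≡0 | inj₂ b≡0 = contradiction (¬-zero-column k a≡0 b≡0) λ ()

    productM-primitive : Primitive A
    productM-primitive = 2 , ℕ.z<s , square-pos {A} (productM-diagonal e l) productM-row productM-column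

open import Data.Nat using (_+_; _<_)

theorem3p7 : ∀ {c ℓ₁ ℓ₂ k} (R : RealField c ℓ₁ ℓ₂) (F : CubicField R k)
    (p q : ℕ) .{{_ : NonZero p}} .{{_ : NonZero q}} → Coprime p q → ¬ (3 ∣ p) →
    (P : Algorithm.ΔK R F p q) (l : ℕ) → 0 < l →
    (∀ n → Algorithm.εₙ R F p q P (n + l) ≡ Algorithm.εₙ R F p q P n) →
    Primitive (productM (Algorithm.εₙ R F p q P) l)
theorem3p7 R F p q _ _ P l 0<l periodic =
  -- `fold P T (suc n)` is by definition `T (fold P T n)`, so `T-step` has the type of a step of the
  -- orbit.
  Orbit.productM-primitive R F p q (fold P T) (εₙ P) (λ n → T-step (fold P T n)) 0<l periodic
  where
  open Algorithm R F p q using (T; εₙ)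
  open OneStep R F p q using (T-step)
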